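{- The first-order theory $VW^*$ interprets the first-order theory $WD_R$ (both defined in the context).
   Context: "Interprets" refers to (relative) formal interpretability in the usual sense. Both theories include the usual axioms for identity. $WD_R$: $B^*$ is the set of nonempty finite strings of 0's and 1's, $^\frown$ is concatenation, and $s\sqsubseteq t$ between strings means $s$ is a (nonempty, possibly improper) initial segment of $t$. The vocabulary has a constant $\underline{s}$ for each $s\in B^*$, a binary relation symbol $\preccurlyeq$ and a ternary relation symbol $C$. Axioms: (1) $C(\underline{s},\underline{t},\underline{s^\frown t})$ for $s,t\in B^*$; (2) $\neg(\underline{s}=\underline{t})$ for distinct $s,t\in B^*$; (3) $\forall x(x\preccurlyeq\underline{t}\leftrightarrow\bigvee_{s\sqsubseteq t}x=\underline{s})$ for $t\in B^*$; (4) $\forall x,y\,\exists z\,C(x,y,z)$; (5) $\forall x,y,u,v\,(C(x,y,u)\ \&\ C(x,y,v)\to u=v)$. $VW^*$: $\Sigma^*$ is the set of finite words over $\{1,2\}$, including the empty word $e$. Signature $\{\underline{e},S_1,S_2,S_3,S_4,\sqsubseteq,\sqsupseteq\}$ ($\underline{e}$ a constant, $S_i$ unary functions, $\sqsubseteq,\sqsupseteq$ binary relations). The canonical term of $e$ is $\underline{e}$, and $\underline{w^\frown d}$ is $S_d(\underline{w})$ for $d\in\{1,2\}$. Axioms: (VW1) $\neg\,\underline{s}=\underline{t}$ for distinct $s,t\in\Sigma^*$; (VW2) $S_d(\underline{t})=\underline{t^\frown d}$ for $t\in\Sigma^*$, $d=1,2$; (VW3) $\underline{e}\sqsubseteq\underline{t}$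 for $t\in\Sigma^*$; (VW4) $\forall x(x\sqsubseteq\underline{e}\to x=\underline{e})$; (VW5) $\forall x(x\sqsubseteq S_d(\underline{t})\leftrightarrow x\sqsubseteq\underline{t}\vee x=S_d(\underline{t}))$ for $t\in\Sigma^*$, $d=1,2$; (VW2*) $S_3(\underline{t})=\underline{1^\frown t}$ and $S_4(\underline{t})=\underline{2^\frown t}$ for $t\in\Sigma^*$; (VW3*) $\underline{e}\sqsupseteq\underline{t}$ for $t\in\Sigma^*$; (VW4*) $\forall x(x\sqsupseteq\underline{e}\to x=\underline{e})$; (VW5*) $\forall x(x\sqsupseteq S_d(\underline{t})\leftrightarrow x\sqsupseteq\underline{t}\vee x=S_d(\underline{t}))$ for $t\in\Sigma^*$, $d=3,4$; (VW10) $\forall x,y(x\sqsubseteq y\ \&\ y\sqsubseteq x\to x=y)$. -}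

module Defs where

open import Data.Nat using (ℕ; zero; suc; _+_)
open import Data.Fin using (Fin; zero; suc; _↑ˡ_; _↑ʳ_; #_)
open import Data.List using (List; []; _∷_; map; foldl; _∷ʳ_)
open import Data.List.NonEmpty as List⁺ using (List⁺; _∷_; _⁺++⁺_)
open import Data.List.Membership.Propositional using (_∈_)
open import Data.Vec using (Vec; []; _∷_)
open import Data.Vec.Functional as Vector using () renaming (_∷_ to _◂_)
open import Data.Product using (Σ-syntax)
open import Function using (_∘_; id)
open import Relation.Binary.PropositionalEquality using (_≢_)

record Signature : Set₁ where
  field
    Func : ℕ → Set   -- symbols of each arity; constants have arity 0
    Rel  : ℕ → Set

open Signature public

-- Well-scoped de Bruijn syntax: the free variables are those of Fin n.

data Term (L : Signature) (n : ℕ) : Set where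
  var : Fin n → Term L n
  fn  : ∀ {k} → Func L k → Vec (Term L n) k → Term L n

infix  9 _≐_
infixr 8 _∧_
infixr 7 _∨_
infixr 6 _⇒_ _⇔_

data Formula (L : Signature) (n : ℕ) : Set where
  ⊥′          : Formula L n
  _≐_         : Term L n → Term L n → Formula L n
  rel         : ∀ {k} → Rel L k → Vec (Term L n) k → Formula L n
  _∧_ _∨_ _⇒_ : Formula L n → Formula L n → Formula L n
  ∀′ ∃′       : Formula L (suc n) → Formula L n

Sentence : Signature → Set
Sentence L = Formula L 0

Theory : Signature → Set₁
Theory L = Sentence L → Set

private
  variable
    L M     : Signature
    k m n   : ℕ

⊤′ : Formula L n
⊤′ = ⊥′ ⇒ ⊥′

¬′_ : Formula L n → Formula L n
¬′ φ = φ ⇒ ⊥′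

_⇔_ : Formula L n → Formula L n → Formula L n
φ ⇔ ψ = (φ ⇒ ψ) ∧ (ψ ⇒ φ)

⋁ : List⁺ (Formula L n) → Formula L n
⋁ = List⁺.foldr₁ _∨_

∃^ : ∀ k → Formula L (k + n) → Formula L n
∃^ zero    φ = φ
∃^ (suc k) φ = ∃^ k (∃′ φ)

mutual
  substT : (Fin n → Term L m) → Term L n → Term L m
  substT σ (var i)   = σ i
  substT σ (fn f ts) = fn f (substTs σ ts)

  substTs : (Fin n → Term L m) → Vec (Term L n) k → Vec (Term L m) k
  substTs σ []       = []
  substTs σ (t ∷ ts) = substT σ t ∷ substTs σ ts

mutual
  renameT : (Fin n → Fin m) → Term L n → Term L m
  renameT ρ (var i)   = var (ρ i)
  renameT ρ (fn f ts) = fn f (renameTs ρ ts)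

  renameTs : (Fin n → Fin m) → Vec (Term L n) k → Vec (Term L m) k
  renameTs ρ []       = []
  renameTs ρ (t ∷ ts) = renameT ρ t ∷ renameTs ρ ts

liftR : (Fin n → Fin m) → Fin (suc n) → Fin (suc m)
liftR ρ zero    = zero
liftR ρ (suc i) = suc (ρ i)

liftS : (Fin n → Term L m) → Fin (suc n) → Term L (suc m)
liftS σ zero    = var zero
liftS σ (suc i) = renameT suc (σ i)

rename : (Fin n → Fin m) → Formula L n → Formula L m
rename ρ ⊥′         = ⊥′
rename ρ (t ≐ u)    = renameT ρ t ≐ renameT ρ u
rename ρ (rel R ts) = rel R (renameTs ρ ts)
rename ρ (φ ∧ ψ)    = rename ρ φ ∧ rename ρ ψ
rename ρ (φ ∨ ψ)    = rename ρ φ ∨ rename ρ ψ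
rename ρ (φ ⇒ ψ)    = rename ρ φ ⇒ rename ρ ψ
rename ρ (∀′ φ)     = ∀′ (rename (liftR ρ) φ)
rename ρ (∃′ φ)     = ∃′ (rename (liftR ρ) φ)

subst : (Fin n → Term L m) → Formula L n → Formula L m
subst σ ⊥′         = ⊥′
subst σ (t ≐ u)    = substT σ t ≐ substT σ u
subst σ (rel R ts) = rel R (substTs σ ts)
subst σ (φ ∧ ψ)    = subst σ φ ∧ subst σ ψ
subst σ (φ ∨ ψ)    = subst σ φ ∨ subst σ ψ
subst σ (φ ⇒ ψ)    = subst σ φ ⇒ subst σ ψ
subst σ (∀′ φ)     = ∀′ (subst (liftS σ) φ)
subst σ (∃′ φ)     = ∃′ (subst (liftS σ) φ)

weaken : Formula L n → Formula L (suc n)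
weaken = rename suc

_[_] : Formula L (suc n) → Term L n → Formula L n
φ [ t ] = subst (t ◂ var) φ

-- Classical natural deduction from the axioms of T and the hypotheses Γ.

infix 3 _∣_⊢_

data _∣_⊢_ {L : Signature} (T : Theory L) {n : ℕ}
           (Γ : List (Formula L n)) : Formula L n → Set where
  axiom   : ∀ {φ} → T φ → T ∣ Γ ⊢ rename Vector.[] φ
  hyp     : ∀ {φ} → φ ∈ Γ → T ∣ Γ ⊢ φ
  raa     : ∀ {φ} → T ∣ (¬′ φ) ∷ Γ ⊢ ⊥′ → T ∣ Γ ⊢ φ
  ⇒-intro : ∀ {φ ψ} → T ∣ φ ∷ Γ ⊢ ψ → T ∣ Γ ⊢ φ ⇒ ψ
  ⇒-elim  : ∀ {φ ψ} → T ∣ Γ ⊢ φ ⇒ ψ → T ∣ Γ ⊢ φ → T ∣ Γ ⊢ ψ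
  ∧-intro : ∀ {φ ψ} → T ∣ Γ ⊢ φ → T ∣ Γ ⊢ ψ → T ∣ Γ ⊢ φ ∧ ψ
  ∧-elim₁ : ∀ {φ ψ} → T ∣ Γ ⊢ φ ∧ ψ → T ∣ Γ ⊢ φ
  ∧-elim₂ : ∀ {φ ψ} → T ∣ Γ ⊢ φ ∧ ψ → T ∣ Γ ⊢ ψ
  ∨-intro₁ : ∀ {φ ψ} → T ∣ Γ ⊢ φ → T ∣ Γ ⊢ φ ∨ ψ
  ∨-intro₂ : ∀ {φ ψ} → T ∣ Γ ⊢ ψ → T ∣ Γ ⊢ φ ∨ ψ
  ∨-elim  : ∀ {φ ψ χ} → T ∣ Γ ⊢ φ ∨ ψ → T ∣ φ ∷ Γ ⊢ χ → T ∣ ψ ∷ Γ ⊢ χ → T ∣ Γ ⊢ χ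
  ∀-intro : ∀ {φ} → T ∣ map weaken Γ ⊢ φ → T ∣ Γ ⊢ ∀′ φ
  ∀-elim  : ∀ {φ} → T ∣ Γ ⊢ ∀′ φ → (t : Term L n) → T ∣ Γ ⊢ φ [ t ]
  ∃-intro : ∀ {φ} (t : Term L n) → T ∣ Γ ⊢ φ [ t ] → T ∣ Γ ⊢ ∃′ φ
  ∃-elim  : ∀ {φ χ} → T ∣ Γ ⊢ ∃′ φ → T ∣ φ ∷ map weaken Γ ⊢ weaken χ → T ∣ Γ ⊢ χ
  ≐-refl  : ∀ {t} → T ∣ Γ ⊢ t ≐ t
  ≐-subst : ∀ {t u} (φ : Formula L (suc n)) → T ∣ Γ ⊢ t ≐ u → T ∣ Γ ⊢ φ [ t ] → T ∣ Γ ⊢ φ [ u ]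
  -- The usual convention that domains are nonempty; with scoped variables it
  -- is not derivable in a signature without constants.
  nonempty : T ∣ Γ ⊢ ∃′ (var zero ≐ var zero)

infix 3 _⊢_

_⊢_ : Theory L → Sentence L → Set
T ⊢ φ = T ∣ [] ⊢ φ

-- One-dimensional, parameter-free, identity-preserving translations.  In fun f
-- variable 0 is the value and variables 1, …, k are the arguments.

record Translation (L M : Signature) : Set where
  field
    dom : Formula M 1
    rl  : ∀ {k} → Rel L k → Formula M k
    fun : ∀ {k} → Func L k → Formula M (suc k)

module _ (τ : Translation L M) where
  open Translation τ

  -- Nested terms are eliminated in favour of their values, which are sought in
  -- the domain:  value t  says that variable 0 is the value of t, and
  -- withValues ts ρ ψ  is  ∃ y₁ … yₖ (⋀ᵢ (dom yᵢ ∧ "yᵢ is the value of tᵢ") ∧ ψ),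
  -- where variables 0, …, k-1 of ψ are y₁, …, yₖ and ρ renames the variables of ts.
  mutual
    value : Term L n → Formula M (suc n)
    value (var i)           = var zero ≐ var (suc i)
    value (fn {k = k} f ts) =
      withValues ts suc (rename ((k ↑ʳ zero) ◂ (_↑ˡ _)) (fun f))

    withValues : Vec (Term L n) k → (Fin n → Fin m) → Formula M (k + m) → Formula M m
    withValues {k = k} {m = m} ts ρ ψ =
      ∃^ k (areValues ts (_↑ˡ m) ((k ↑ʳ_) ∘ ρ) ∧ ψ)

    areValues : Vec (Term L n) k → (Fin k → Fin m) → (Fin n → Fin m) → Formula M m
    areValues []       ys ρ = ⊤′
    areValues (t ∷ ts) ys ρ =
      (rename (λ _ → ys zero) dom
        ∧ rename (ys zero ◂ ρ) (value t))
      ∧ areValues ts (ys ∘ suc) ρ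

  translate : Formula L n → Formula M n
  translate ⊥′         = ⊥′
  translate (t ≐ u)    = withValues (t ∷ u ∷ []) id (var zero ≐ var (suc zero))
  translate (rel R ts) = withValues ts id (rename (_↑ˡ _) (rl R))
  translate (φ ∧ ψ)    = translate φ ∧ translate ψ
  translate (φ ∨ ψ)    = translate φ ∨ translate ψ
  translate (φ ⇒ ψ)    = translate φ ⇒ translate ψ
  translate (∀′ φ)     = ∀′ (rename (λ _ → zero) dom ⇒ translate φ)
  translate (∃′ φ)     = ∃′ (rename (λ _ → zero) dom ∧ translate φ)

-- Preservation of all theorems of S subsumes the usual side conditions: since
-- S proves ∃x (x = x), ∃x (x = f y) and (x = f y ∧ z = f y → x = z), the domain
-- is provably nonempty and each  fun f  provably defines a function on it.
_Interprets_ : Theory M → Theory L → Set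
_Interprets_ {M} {L} T S =
  Σ[ τ ∈ Translation L M ] (∀ (φ : Sentence L) → S ⊢ φ → T ⊢ translate τ φ)

data Bit : Set where
  𝟘 𝟙 : Bit

B* : Set
B* = List⁺ Bit

initialSegments : B* → List⁺ B*
initialSegments (b ∷ bs) = List⁺.map (b ∷_) (List⁺.inits bs)

data WDFunc : ℕ → Set where
  const : B* → WDFunc 0

data WDRel : ℕ → Set where
  ≼-sym : WDRel 2
  C-sym : WDRel 3

WDSig : Signature
WDSig = record { Func = WDFunc ; Rel = WDRel }

str : B* → Term WDSig n
str s = fn (const s) []

infix 9 _≼_

_≼_ : Term WDSig n → Term WDSig n → Formula WDSig n
t ≼ u = rel ≼-sym (t ∷ u ∷ [])

C : Term WDSig n → Term WDSig n → Term WDSig n → Formula WDSig n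
C t u v = rel C-sym (t ∷ u ∷ v ∷ [])

data WD_R : Theory WDSig where
  wd1 : ∀ s t → WD_R (C (str s) (str t) (str (s ⁺++⁺ t)))
  wd2 : ∀ s t → s ≢ t → WD_R (¬′ (str s ≐ str t))
  wd3 : ∀ t → WD_R (∀′ (var (# 0) ≼ str t
                        ⇔ ⋁ (List⁺.map (λ s → var (# 0) ≐ str s) (initialSegments t))))
  wd4 : WD_R (∀′ (∀′ (∃′ (C (var (# 2)) (var (# 1)) (var (# 0))))))
  wd5 : WD_R (∀′ (∀′ (∀′ (∀′
          (C (var (# 3)) (var (# 2)) (var (# 1)) ∧ C (var (# 3)) (var (# 2)) (var (# 0))
            ⇒ var (# 1) ≐ var (# 0))))))

data Letter : Set where
  𝟏 𝟐 : Letter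

Σ* : Set
Σ* = List Letter

data VWFunc : ℕ → Set where
  e-sym           : VWFunc 0
  S₁ S₂ S₃ S₄     : VWFunc 1

data VWRel : ℕ → Set where
  ⊑-sym ⊒-sym : VWRel 2

VWSig : Signature
VWSig = record { Func = VWFunc ; Rel = VWRel }

ε : Term VWSig n
ε = fn e-sym []

append : Letter → Term VWSig n → Term VWSig n
append 𝟏 t = fn S₁ (t ∷ [])
append 𝟐 t = fn S₂ (t ∷ [])

prepend : Letter → Term VWSig n → Term VWSig n
prepend 𝟏 t = fn S₃ (t ∷ [])
prepend 𝟐 t = fn S₄ (t ∷ [])

infix 9 _⊑_ _⊒_

_⊑_ _⊒_ : Term VWSig n → Term VWSig n → Formula VWSig n
t ⊑ u = rel ⊑-sym (t ∷ u ∷ [])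
t ⊒ u = rel ⊒-sym (t ∷ u ∷ [])

-- The canonical term of d₁d₂…dₖ is S_{dₖ}(… S_{d₂}(S_{d₁}(e)) …).
word : Σ* → Term VWSig n
word = foldl (λ t d → append d t) ε

data VW* : Theory VWSig where
  vw1  : ∀ s t → s ≢ t → VW* (¬′ (word s ≐ word t))
  vw2  : ∀ d t → VW* (append d (word t) ≐ word (t ∷ʳ d))
  vw3  : ∀ t → VW* (ε ⊑ word t)
  vw4  : VW* (∀′ (var (# 0) ⊑ ε ⇒ var (# 0) ≐ ε))
  vw5  : ∀ d t → VW* (∀′ (var (# 0) ⊑ append d (word t)
                          ⇔ var (# 0) ⊑ word t ∨ var (# 0) ≐ append d (word t)))
  vw2* : ∀ d t → VW* (prepend d (word t) ≐ word (d ∷ t))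
  vw3* : ∀ t → VW* (ε ⊒ word t)
  vw4* : VW* (∀′ (var (# 0) ⊒ ε ⇒ var (# 0) ≐ ε))
  vw5* : ∀ d t → VW* (∀′ (var (# 0) ⊒ prepend d (word t)
                          ⇔ var (# 0) ⊒ word t ∨ var (# 0) ≐ prepend d (word t)))
  vw10 : VW* (∀′ (∀′ (var (# 1) ⊑ var (# 0) ∧ var (# 0) ⊑ var (# 1)
                      ⇒ var (# 1) ≐ var (# 0))))

module Submission where

-- The bits 0 and 1 are coded by the words 1 and 21, so that concatenation of
-- strings becomes concatenation of code words and the nonempty initial segments
-- of a string become the prefixes ending in 1.  Concatenation is defined by
-- z = xy iff some word W codes a relation that contains (e , x), is closed under
-- appending the same coded bit to both components while the first remains a
-- prefix of y, and relates y to z only.  For standard x and y every such W, even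
-- a nonstandard one, must relate y to xy, by finitely many closure steps; hence
-- z = xy no matter which formula is used to read a relation off W.  It remains
-- to find one such W.  The formula chosen is bounded, so VW* decides it on
-- standard words, and it suffices to check in the standard model that the word
-- listing the pairs (v , xv), v a prefix of y, works: the markers 221 and 2221
-- separate the entries, since 22 does not occur in code words.


open import Defs
open import Data.Empty using (⊥)
open import Data.Fin using (Fin; zero; suc; #_; _↑ˡ_; _↑ʳ_)
open import Data.List using (List; []; _∷_; _++_; _∷ʳ_; concatMap; foldl; inits; map; replicate)
open import Data.List.Membership.Propositional using (_∈_)
open import Data.List.Membership.Propositional.Properties using (∈-map⁺; ∈-map⁻; ∈-∃++)
open import Data.List.NonEmpty as List⁺ using (_∷_; _⁺++⁺_)
open import Data.List.Properties
  using (++-assoc; ++-cancelˡ; ++-identityʳ; concatMap-++; foldl-++; foldl-∷ʳ; map-++; ≡-dec;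
         ∷-injectiveˡ; ∷-injectiveʳ)
open import Data.List.Relation.Binary.Subset.Propositional using (_⊆_)
open import Data.List.Relation.Binary.Subset.Propositional.Properties using (map⁺; ∷⁺ʳ)
open import Data.List.Relation.Unary.Any using (here; there)
open import Data.List.Reverse using (Reverse; reverseView; []; _∶_∶ʳ_)
open import Data.Nat using (ℕ; zero; suc; _+_)
open import Data.Nat.Properties using (+-identityʳ; +-suc)
open import Data.Product using (∃; ∃₂; _×_; _,_; proj₁; proj₂)
open import Data.Sum using (_⊎_; inj₁; inj₂)
open import Data.Vec using (Vec; []; _∷_; lookup)
open import Data.Vec.Functional as Vector using () renaming (_∷_ to _◂_)
open import Function using (_∘_; id)
open import Relation.Binary.PropositionalEquality
  using (_≡_; _≢_; _≗_; refl; sym; trans; cong; cong₂; subst₂; module ≡-Reasoning)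
  renaming (subst to ≡-subst)
open import Relation.Nullary using (¬_; Dec; yes; no; contradiction)
open import Relation.Nullary.Decidable using (decidable-stable; map′)

-- `VW*` has no induction and says little about nonstandard words. Its axioms do determine, for each
-- standard word, what lies below it in either order, and therefore decide every bounded formula at
-- standard arguments. Axioms (2) and (3) of `WD_R` come down to this. Axioms (4) and (5) quantify
-- over everything; logic alone forces them, by admitting z as a value only if it is the unique
-- solution of the defining formula, with e as default. Axiom (1) then demands that for standard x
-- and y the solution xy be unique even among nonstandard z. This shapes the closure clause: its
-- quantifiers must be bounded, hence they range over prefixes of y and of the candidate z, and it
-- also has to assert that the extended second component is again a prefix of z, because the next
-- step needs that bound. Since the only functions available add single letters, an entry (v , w) of
-- W cannot be written as one term in v and w; it is pinned down by a prefix, a suffix and the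
-- single position of its middle marker.

private
  variable
    L     : Signature
    k m n o : ℕ

-- Substitution calculus for terms and formulas

mutual
  -- Substitutions are functions and are compared pointwise throughout, so each operation needs its
  -- own congruence law.
  substT-cong : {σ τ : Fin n → Term L m} → σ ≗ τ → substT σ ≗ substT τ
  substT-cong eq (var i)   = eq i
  substT-cong eq (fn f ts) = cong (fn f) (substTs-cong eq ts)

  substTs-cong : {σ τ : Fin n → Term L m} → σ ≗ τ → substTs {k = k} σ ≗ substTs τ
  substTs-cong eq []       = refl
  substTs-cong eq (t ∷ ts) = cong₂ _∷_ (substT-cong eq t) (substTs-cong eq ts)

mutual
  substT-var : (t : Term L n) → substT var t ≡ t
  substT-var (var i)   = refl
  substT-var (fn f ts) = cong (fn f) (substTs-var ts)

  substTs-var : (ts : Vec (Term L n) k) → substTs var ts ≡ ts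
  substTs-var []       = refl
  substTs-var (t ∷ ts) = cong₂ _∷_ (substT-var t) (substTs-var ts)

mutual
  substT-substT : (τ : Fin m → Term L o) (σ : Fin n → Term L m) (t : Term L n) →
                  substT τ (substT σ t) ≡ substT (substT τ ∘ σ) t
  substT-substT τ σ (var i)   = refl
  substT-substT τ σ (fn f ts) = cong (fn f) (substTs-substTs τ σ ts)

  substTs-substTs : (τ : Fin m → Term L o) (σ : Fin n → Term L m) (ts : Vec (Term L n) k) →
                    substTs τ (substTs σ ts) ≡ substTs (substT τ ∘ σ) ts
  substTs-substTs τ σ []       = refl
  substTs-substTs τ σ (t ∷ ts) = cong₂ _∷_ (substT-substT τ σ t) (substTs-substTs τ σ ts)

mutual
  renameT-as-substT : (ρ : Fin n → Fin m) (t : Term L n) → renameT ρ t ≡ substT (var ∘ ρ) t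
  renameT-as-substT ρ (var i)   = refl
  renameT-as-substT ρ (fn f ts) = cong (fn f) (renameTs-as-substTs ρ ts)

  renameTs-as-substTs : (ρ : Fin n → Fin m) (ts : Vec (Term L n) k) →
                        renameTs ρ ts ≡ substTs (var ∘ ρ) ts
  renameTs-as-substTs ρ []       = refl
  renameTs-as-substTs ρ (t ∷ ts) = cong₂ _∷_ (renameT-as-substT ρ t) (renameTs-as-substTs ρ ts)

substT-renameT : (τ : Fin m → Term L o) (ρ : Fin n → Fin m) (t : Term L n) →
                 substT τ (renameT ρ t) ≡ substT (τ ∘ ρ) t
substT-renameT τ ρ t = trans (cong (substT τ) (renameT-as-substT ρ t)) (substT-substT τ (var ∘ ρ) t)

renameT-substT : (ρ : Fin m → Fin o) (σ : Fin n → Term L m) (t : Term L n) →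
                 renameT ρ (substT σ t) ≡ substT (renameT ρ ∘ σ) t
renameT-substT ρ σ t = trans (renameT-as-substT ρ (substT σ t)) (trans (substT-substT (var ∘ ρ) σ t)
  (substT-cong (λ i → sym (renameT-as-substT ρ (σ i))) t))

substT-weaken : (u : Term L n) (t : Term L n) → substT (u ◂ var) (renameT suc t) ≡ t
substT-weaken u t = trans (substT-renameT (u ◂ var) suc t) (substT-var t)

liftS-cong : {σ τ : Fin n → Term L m} → σ ≗ τ → liftS σ ≗ liftS τ
liftS-cong eq zero    = refl
liftS-cong eq (suc i) = cong (renameT suc) (eq i)

subst-cong : {σ τ : Fin n → Term L m} → σ ≗ τ → subst σ ≗ subst τ
subst-cong eq ⊥′         = refl
subst-cong eq (t ≐ u)    = cong₂ _≐_ (substT-cong eq t) (substT-cong eq u)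
subst-cong eq (rel R ts) = cong (rel R) (substTs-cong eq ts)
subst-cong eq (φ ∧ ψ)    = cong₂ _∧_ (subst-cong eq φ) (subst-cong eq ψ)
subst-cong eq (φ ∨ ψ)    = cong₂ _∨_ (subst-cong eq φ) (subst-cong eq ψ)
subst-cong eq (φ ⇒ ψ)    = cong₂ _⇒_ (subst-cong eq φ) (subst-cong eq ψ)
subst-cong eq (∀′ φ)     = cong ∀′ (subst-cong (liftS-cong eq) φ)
subst-cong eq (∃′ φ)     = cong ∃′ (subst-cong (liftS-cong eq) φ)

liftS-var : liftS {L = L} (var {n = n}) ≗ var
liftS-var zero    = refl
liftS-var (suc i) = refl

subst-var : (φ : Formula L n) → subst var φ ≡ φ
subst-var ⊥′         = refl
subst-var (t ≐ u)    = cong₂ _≐_ (substT-var t) (substT-var u)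
subst-var (rel R ts) = cong (rel R) (substTs-var ts)
subst-var (φ ∧ ψ)    = cong₂ _∧_ (subst-var φ) (subst-var ψ)
subst-var (φ ∨ ψ)    = cong₂ _∨_ (subst-var φ) (subst-var ψ)
subst-var (φ ⇒ ψ)    = cong₂ _⇒_ (subst-var φ) (subst-var ψ)
subst-var (∀′ φ)     = cong ∀′ (trans (subst-cong liftS-var φ) (subst-var φ))
subst-var (∃′ φ)     = cong ∃′ (trans (subst-cong liftS-var φ) (subst-var φ))

liftS-substT : (τ : Fin m → Term L o) (σ : Fin n → Term L m) →
               substT (liftS τ) ∘ liftS σ ≗ liftS (substT τ ∘ σ)
liftS-substT τ σ zero    = refl
liftS-substT τ σ (suc i) =
  trans (substT-renameT (liftS τ) suc (σ i)) (sym (renameT-substT suc τ (σ i)))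

subst-subst : (τ : Fin m → Term L o) (σ : Fin n → Term L m) (φ : Formula L n) →
              subst τ (subst σ φ) ≡ subst (substT τ ∘ σ) φ
subst-subst τ σ ⊥′         = refl
subst-subst τ σ (t ≐ u)    = cong₂ _≐_ (substT-substT τ σ t) (substT-substT τ σ u)
subst-subst τ σ (rel R ts) = cong (rel R) (substTs-substTs τ σ ts)
subst-subst τ σ (φ ∧ ψ)    = cong₂ _∧_ (subst-subst τ σ φ) (subst-subst τ σ ψ)
subst-subst τ σ (φ ∨ ψ)    = cong₂ _∨_ (subst-subst τ σ φ) (subst-subst τ σ ψ)
subst-subst τ σ (φ ⇒ ψ)    = cong₂ _⇒_ (subst-subst τ σ φ) (subst-subst τ σ ψ)
subst-subst τ σ (∀′ φ)     =
  cong ∀′ (trans (subst-subst (liftS τ) (liftS σ) φ) (subst-cong (liftS-substT τ σ) φ))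
subst-subst τ σ (∃′ φ)     =
  cong ∃′ (trans (subst-subst (liftS τ) (liftS σ) φ) (subst-cong (liftS-substT τ σ) φ))

liftR-as-liftS : (ρ : Fin n → Fin m) → var {L = L} ∘ liftR ρ ≗ liftS (var ∘ ρ)
liftR-as-liftS ρ zero    = refl
liftR-as-liftS ρ (suc i) = refl

rename-as-subst : (ρ : Fin n → Fin m) (φ : Formula L n) → rename ρ φ ≡ subst (var ∘ ρ) φ
rename-as-subst ρ ⊥′         = refl
rename-as-subst ρ (t ≐ u)    = cong₂ _≐_ (renameT-as-substT ρ t) (renameT-as-substT ρ u)
rename-as-subst ρ (rel R ts) = cong (rel R) (renameTs-as-substTs ρ ts)
rename-as-subst ρ (φ ∧ ψ)    = cong₂ _∧_ (rename-as-subst ρ φ) (rename-as-subst ρ ψ)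
rename-as-subst ρ (φ ∨ ψ)    = cong₂ _∨_ (rename-as-subst ρ φ) (rename-as-subst ρ ψ)
rename-as-subst ρ (φ ⇒ ψ)    = cong₂ _⇒_ (rename-as-subst ρ φ) (rename-as-subst ρ ψ)
rename-as-subst ρ (∀′ φ)     =
  cong ∀′ (trans (rename-as-subst (liftR ρ) φ) (subst-cong (liftR-as-liftS ρ) φ))
rename-as-subst ρ (∃′ φ)     =
  cong ∃′ (trans (rename-as-subst (liftR ρ) φ) (subst-cong (liftR-as-liftS ρ) φ))

subst-rename : (τ : Fin m → Term L o) (ρ : Fin n → Fin m) (φ : Formula L n) →
               subst τ (rename ρ φ) ≡ subst (τ ∘ ρ) φ
subst-rename τ ρ φ = trans (cong (subst τ) (rename-as-subst ρ φ)) (subst-subst τ (var ∘ ρ) φ)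

rename-subst : (ρ : Fin m → Fin o) (σ : Fin n → Term L m) (φ : Formula L n) →
               rename ρ (subst σ φ) ≡ subst (renameT ρ ∘ σ) φ
rename-subst ρ σ φ = trans (rename-as-subst ρ (subst σ φ)) (trans (subst-subst (var ∘ ρ) σ φ)
  (subst-cong (λ i → sym (renameT-as-substT ρ (σ i))) φ))

rename-rename : (ρ′ : Fin m → Fin o) (ρ : Fin n → Fin m) (φ : Formula L n) →
                rename ρ′ (rename ρ φ) ≡ rename (ρ′ ∘ ρ) φ
rename-rename ρ′ ρ φ = trans (rename-as-subst ρ′ (rename ρ φ))
  (trans (subst-rename (var ∘ ρ′) ρ φ) (sym (rename-as-subst (ρ′ ∘ ρ) φ)))

subst-[] : (σ : Fin k → Term L (suc n)) (φ : Formula L k) (t : Term L n) →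
           subst σ φ [ t ] ≡ subst (substT (t ◂ var) ∘ σ) φ
subst-[] σ φ t = subst-subst (t ◂ var) σ φ

-- The form in which the quantifier rules are used: instantiating a quantifier under `σ` extends `σ`
-- by the instance.
liftS-[] : (σ : Fin k → Term L n) (φ : Formula L (suc k)) (t : Term L n) →
           subst (liftS σ) φ [ t ] ≡ subst (t ◂ σ) φ
liftS-[] σ φ t = trans (subst-[] (liftS σ) φ t)
  (subst-cong (λ { zero → refl ; (suc i) → substT-weaken t (σ i) }) φ)

liftR-suc-[] : (φ : Formula L (suc n)) → rename (liftR suc) φ [ var zero ] ≡ φ
liftR-suc-[] φ = trans (subst-rename (var zero ◂ var) (liftR suc) φ)
  (trans (subst-cong (λ { zero → refl ; (suc i) → refl }) φ) (subst-var φ))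

-- The instantiation that fits the block of quantifiers `∃^ k`.
extend : ∀ k → (Fin k → Term L n) → Fin (k + n) → Term L n
extend zero    σ = var
extend (suc k) σ = σ zero ◂ extend k (σ ∘ suc)

extend-↑ˡ : ∀ k (σ : Fin k → Term L n) i → extend k σ (i ↑ˡ n) ≡ σ i
extend-↑ˡ (suc k) σ zero    = refl
extend-↑ˡ (suc k) σ (suc i) = extend-↑ˡ k (σ ∘ suc) i

extend-↑ʳ : ∀ k (σ : Fin k → Term L n) i → extend k σ (k ↑ʳ i) ≡ var i
extend-↑ʳ zero    σ i = refl
extend-↑ʳ (suc k) σ i = extend-↑ʳ k (σ ∘ suc) i

substT-extend-↑ʳ : ∀ k (σ : Fin k → Term L n) t → substT (extend k σ) (renameT (k ↑ʳ_) t) ≡ t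
substT-extend-↑ʳ k σ t = trans (substT-renameT (extend k σ) (k ↑ʳ_) t)
  (trans (substT-cong (extend-↑ʳ k σ) t) (substT-var t))

-- Natural deduction

module _ {T : Theory L} where

  private
    variable
      Γ         : List (Formula L n)
      φ ψ χ     : Formula L n

  cast : φ ≡ ψ → T ∣ Γ ⊢ φ → T ∣ Γ ⊢ ψ
  cast = ≡-subst (T ∣ _ ⊢_)

  hyp₀ : T ∣ φ ∷ Γ ⊢ φ
  hyp₀ = hyp (here refl)

  hyp₁ : T ∣ ψ ∷ φ ∷ Γ ⊢ φ
  hyp₁ = hyp (there (here refl))

  hyp₂ : T ∣ χ ∷ ψ ∷ φ ∷ Γ ⊢ φ
  hyp₂ = hyp (there (there (here refl)))

  ⊤-intro : T ∣ Γ ⊢ ⊤′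
  ⊤-intro = ⇒-intro hyp₀

  ex-falso : T ∣ Γ ⊢ ⊥′ → T ∣ Γ ⊢ φ
  ex-falso = ⇒-elim (⇒-intro (raa hyp₁))

  weakening : {Γ Δ : List (Formula L n)} → Γ ⊆ Δ → T ∣ Γ ⊢ φ → T ∣ Δ ⊢ φ
  weakening s (axiom x)       = axiom x
  weakening s (hyp x)         = hyp (s x)
  weakening s (raa p)         = raa (weakening (∷⁺ʳ _ s) p)
  weakening s (⇒-intro p)     = ⇒-intro (weakening (∷⁺ʳ _ s) p)
  weakening s (⇒-elim p q)    = ⇒-elim (weakening s p) (weakening s q)
  weakening s (∧-intro p q)   = ∧-intro (weakening s p) (weakening s q)
  weakening s (∧-elim₁ p)     = ∧-elim₁ (weakening s p)
  weakening s (∧-elim₂ p)     = ∧-elim₂ (weakening s p)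
  weakening s (∨-intro₁ p)    = ∨-intro₁ (weakening s p)
  weakening s (∨-intro₂ p)    = ∨-intro₂ (weakening s p)
  weakening s (∨-elim p q r)  =
    ∨-elim (weakening s p) (weakening (∷⁺ʳ _ s) q) (weakening (∷⁺ʳ _ s) r)
  weakening s (∀-intro p)     = ∀-intro (weakening (map⁺ weaken s) p)
  weakening s (∀-elim p t)    = ∀-elim (weakening s p) t
  weakening s (∃-intro t p)   = ∃-intro t (weakening s p)
  weakening s (∃-elim p q)    =
    ∃-elim (weakening s p) (weakening (∷⁺ʳ _ (map⁺ weaken s)) q)
  weakening s ≐-refl          = ≐-refl
  weakening s (≐-subst φ p q) = ≐-subst φ (weakening s p) (weakening s q)
  weakening s nonempty        = nonempty

  wk : T ∣ Γ ⊢ φ → T ∣ ψ ∷ Γ ⊢ φ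
  wk = weakening there

  by-contradiction : T ∣ (¬′ φ) ∷ Γ ⊢ φ → T ∣ Γ ⊢ φ
  by-contradiction p = raa (⇒-elim hyp₀ p)

  excluded-middle : T ∣ Γ ⊢ φ ∨ (¬′ φ)
  excluded-middle = by-contradiction (∨-intro₂ (⇒-intro (⇒-elim hyp₁ (∨-intro₁ hyp₀))))

  ⇔-refl : T ∣ Γ ⊢ φ ⇔ φ
  ⇔-refl = ∧-intro (⇒-intro hyp₀) (⇒-intro hyp₀)

  ⇔-to : T ∣ Γ ⊢ φ ⇔ ψ → T ∣ Γ ⊢ φ → T ∣ Γ ⊢ ψ
  ⇔-to p = ⇒-elim (∧-elim₁ p)

  ⇔-from : T ∣ Γ ⊢ φ ⇔ ψ → T ∣ Γ ⊢ ψ → T ∣ Γ ⊢ φ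
  ⇔-from p = ⇒-elim (∧-elim₂ p)

  ∀-elim-liftS : (σ : Fin k → Term L n) (φ : Formula L (suc k)) (t : Term L n) →
                 T ∣ Γ ⊢ ∀′ (subst (liftS σ) φ) → T ∣ Γ ⊢ subst (t ◂ σ) φ
  ∀-elim-liftS σ φ t p = cast (liftS-[] σ φ t) (∀-elim p t)

  ∃-intro-liftS : (σ : Fin k → Term L n) (φ : Formula L (suc k)) (t : Term L n) →
                  T ∣ Γ ⊢ subst (t ◂ σ) φ → T ∣ Γ ⊢ ∃′ (subst (liftS σ) φ)
  ∃-intro-liftS σ φ t p = ∃-intro t (cast (sym (liftS-[] σ φ t)) p)

  ∀-elim-hyp : T ∣ map weaken (∀′ φ ∷ Γ) ⊢ φ
  ∀-elim-hyp {φ = φ} = cast (liftR-suc-[] φ) (∀-elim hyp₀ (var zero))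

  ∀-mono : (∀ {Δ} → T ∣ φ ∷ Δ ⊢ ψ) → T ∣ Γ ⊢ ∀′ φ → T ∣ Γ ⊢ ∀′ ψ
  ∀-mono p = ⇒-elim (⇒-intro (∀-intro (⇒-elim (⇒-intro p) ∀-elim-hyp)))

  ∃-mono : (∀ {Δ} → T ∣ φ ∷ Δ ⊢ ψ) → T ∣ Γ ⊢ ∃′ φ → T ∣ Γ ⊢ ∃′ ψ
  ∃-mono {ψ = ψ} p q =
    ∃-elim q (∃-intro (var zero) (cast (sym (liftR-suc-[] ψ)) p))

  -- `≐-subst` replaces one variable, so the terms are exchanged one at a time. The recursive call
  -- works on `φ` with the new value already in place of variable 0, renamed past the k variables
  -- still pending.
  ≐-replace-first : ∀ k (φ : Formula L (k + n)) (σ τ : Fin k → Term L n) →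
                    (∀ i → T ∣ Γ ⊢ σ i ≐ τ i) →
                    T ∣ Γ ⊢ subst (extend k σ) φ → T ∣ Γ ⊢ subst (extend k τ) φ
  ≐-replace-first zero    φ σ τ eq p = p
  ≐-replace-first (suc k) φ σ τ eq p =
    cast (instantiated (τ ∘ suc))
      (≐-replace-first k (φ [ τ₀ ]) (σ ∘ suc) (τ ∘ suc) (eq ∘ suc)
        (cast (sym (instantiated (σ ∘ suc))) first-replaced))
    where
    τ₀ = renameT (k ↑ʳ_) (τ zero)

    instantiated : ∀ σ′ → subst (extend k σ′) (φ [ τ₀ ]) ≡ subst (τ zero ◂ extend k σ′) φ
    instantiated σ′ = trans (subst-subst (extend k σ′) (τ₀ ◂ var) φ)
      (subst-cong (λ { zero → substT-extend-↑ʳ k σ′ (τ zero) ; (suc i) → refl }) φ)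

    first-replaced : T ∣ _ ⊢ subst (τ zero ◂ extend k (σ ∘ suc)) φ
    first-replaced = cast (liftS-[] (extend k (σ ∘ suc)) φ (τ zero))
      (≐-subst (subst (liftS (extend k (σ ∘ suc))) φ) (eq zero)
        (cast (sym (liftS-[] (extend k (σ ∘ suc)) φ (σ zero)))
          (cast (subst-cong (λ { zero → refl ; (suc i) → refl }) φ) p)))

  ≐-replace : (φ : Formula L k) {σ τ : Fin k → Term L n} → (∀ i → T ∣ Γ ⊢ σ i ≐ τ i) →
              T ∣ Γ ⊢ subst σ φ → T ∣ Γ ⊢ subst τ φ
  ≐-replace {k} φ {σ} {τ} eq p =
    cast (extended τ) (≐-replace-first k (rename (_↑ˡ _) φ) σ τ eq (cast (sym (extended σ)) p))
    where
    extended : ∀ σ′ → subst (extend k σ′) (rename (_↑ˡ _) φ) ≡ subst σ′ φ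
    extended σ′ = trans (subst-rename (extend k σ′) (_↑ˡ _) φ) (subst-cong (extend-↑ˡ k σ′) φ)

  private
    variable
      t t′ u u′ v : Term L n

  ≐-replace₂ : (φ : Formula L 2) → T ∣ Γ ⊢ t ≐ t′ → T ∣ Γ ⊢ u ≐ u′ →
               T ∣ Γ ⊢ subst (t ◂ u ◂ Vector.[]) φ → T ∣ Γ ⊢ subst (t′ ◂ u′ ◂ Vector.[]) φ
  ≐-replace₂ φ p q = ≐-replace φ (λ { zero → p ; (suc zero) → q })

  ≐-sym : T ∣ Γ ⊢ t ≐ u → T ∣ Γ ⊢ u ≐ t
  ≐-sym p = ≐-replace₂ (var zero ≐ var (suc zero)) p ≐-refl ≐-refl

  ≐-trans : T ∣ Γ ⊢ t ≐ u → T ∣ Γ ⊢ u ≐ v → T ∣ Γ ⊢ t ≐ v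
  ≐-trans p q = ≐-replace₂ (var zero ≐ var (suc zero)) ≐-refl q p

  ≐-cong₁ : (f : Func L 1) → T ∣ Γ ⊢ t ≐ u → T ∣ Γ ⊢ fn f (t ∷ []) ≐ fn f (u ∷ [])
  ≐-cong₁ f p =
    ≐-replace₂ (fn f (var zero ∷ []) ≐ fn f (var (suc zero) ∷ [])) ≐-refl p ≐-refl

  ∃^-mono : ∀ k {φ ψ : Formula L (k + n)} → (∀ {Δ} → T ∣ φ ∷ Δ ⊢ ψ) →
            T ∣ Γ ⊢ ∃^ k φ → T ∣ Γ ⊢ ∃^ k ψ
  ∃^-mono zero    p q = ⇒-elim (⇒-intro p) q
  ∃^-mono (suc k) p q = ∃^-mono k (∃-mono p hyp₀) q

  ∃^-elim : ∀ k {φ : Formula L (k + n)} {χ : Formula L n} →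
            (∀ {Δ} → T ∣ φ ∷ Δ ⊢ rename (k ↑ʳ_) χ) → T ∣ Γ ⊢ ∃^ k φ → T ∣ Γ ⊢ χ
  ∃^-elim zero    {χ = χ} p q =
    ⇒-elim (⇒-intro (cast (trans (rename-as-subst _ χ) (subst-var χ)) p)) q
  ∃^-elim (suc k) {χ = χ} p q =
    ∃^-elim k (∃-elim hyp₀ (cast (sym (rename-rename suc (k ↑ʳ_) χ)) p)) q

  ∃^-intro : ∀ k (φ : Formula L (k + n)) (σ : Fin k → Term L n) →
             T ∣ Γ ⊢ subst (extend k σ) φ → T ∣ Γ ⊢ ∃^ k φ
  ∃^-intro zero    φ σ p = cast (subst-var φ) p
  ∃^-intro (suc k) φ σ p = ∃^-intro k (∃′ φ) (σ ∘ suc)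
    (∃-intro-liftS (extend k (σ ∘ suc)) φ (σ zero)
      (cast (subst-cong (λ { zero → refl ; (suc i) → refl }) φ) p))

-- Canonical words, and translation without nested terms

renameT-append : (ρ : Fin n → Fin m) → ∀ d t → renameT ρ (append d t) ≡ append d (renameT ρ t)
renameT-append ρ 𝟏 t = refl
renameT-append ρ 𝟐 t = refl

renameT-word : (ρ : Fin n → Fin m) → ∀ w → renameT ρ (word w) ≡ word w
renameT-word {n} {m} ρ w = go w ε
  where
  go : ∀ w t → renameT ρ (foldl (λ t d → append d t) t w) ≡ foldl (λ t d → append d t) (renameT ρ t) w
  go []      t = refl
  go (d ∷ w) t = trans (go w (append d t)) (cong (λ t′ → foldl _ t′ w) (renameT-append ρ d t))

substT-word : (σ : Fin n → Term VWSig m) → ∀ w → substT σ (word w) ≡ word w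
substT-word {n} {m} σ w = begin
  substT σ (word w)                 ≡⟨ cong (substT σ) (sym (renameT-word closed w)) ⟩
  substT σ (renameT closed (word w)) ≡⟨ substT-renameT σ closed (word w) ⟩
  substT (σ ∘ closed) (word w)      ≡⟨ substT-cong (λ ()) (word w) ⟩
  substT (var ∘ closed) (word w)    ≡⟨ sym (renameT-as-substT closed (word w)) ⟩
  renameT closed (word w)           ≡⟨ renameT-word closed w ⟩
  word w                            ∎
  where
  open ≡-Reasoning
  closed : ∀ {o} → Fin 0 → Fin o
  closed ()

-- The interpretations considered here have the whole universe as domain and
-- interpret constants by words, so nested terms need not be unravelled.
module Direct (code : B* → Σ*) (relF : ∀ {k} → WDRel k → Formula VWSig k) where

  τ : Translation WDSig VWSig
  τ = record { dom = ⊤′ ; rl = relF ; fun = λ { (const s) → var zero ≐ word (code s) } }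

  directT : Term WDSig n → Term VWSig n
  directT (var i)           = var i
  directT (fn (const s) []) = word (code s)

  direct : Formula WDSig n → Formula VWSig n
  direct ⊥′         = ⊥′
  direct (t ≐ u)    = directT t ≐ directT u
  direct (rel R ts) = subst (directT ∘ lookup ts) (relF R)
  direct (φ ∧ ψ)    = direct φ ∧ direct ψ
  direct (φ ∨ ψ)    = direct φ ∨ direct ψ
  direct (φ ⇒ ψ)    = direct φ ⇒ direct ψ
  direct (∀′ φ)     = ∀′ (direct φ)
  direct (∃′ φ)     = ∃′ (direct φ)

  directT-substT : (σ : Fin n → Term WDSig m) → ∀ t →
                   directT (substT σ t) ≡ substT (directT ∘ σ) (directT t)
  directT-substT σ (var i)           = refl
  directT-substT σ (fn (const s) []) = sym (substT-word (directT ∘ σ) (code s))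

  directT-renameT : (ρ : Fin n → Fin m) → ∀ t → directT (renameT ρ t) ≡ renameT ρ (directT t)
  directT-renameT ρ (var i)           = refl
  directT-renameT ρ (fn (const s) []) = sym (renameT-word ρ (code s))

  lookup-substTs : (σ : Fin n → Term L m) (ts : Vec (Term L n) k) → ∀ i →
                   lookup (substTs σ ts) i ≡ substT σ (lookup ts i)
  lookup-substTs σ (t ∷ ts) zero    = refl
  lookup-substTs σ (t ∷ ts) (suc i) = lookup-substTs σ ts i

  direct-subst : (σ : Fin n → Term WDSig m) → ∀ φ →
                 direct (subst σ φ) ≡ subst (directT ∘ σ) (direct φ)
  direct-subst σ ⊥′         = refl
  direct-subst σ (t ≐ u)    = cong₂ _≐_ (directT-substT σ t) (directT-substT σ u)
  direct-subst σ (rel R ts) = trans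
    (subst-cong (λ i → trans (cong directT (lookup-substTs σ ts i)) (directT-substT σ (lookup ts i))) (relF R))
    (sym (subst-subst (directT ∘ σ) (directT ∘ lookup ts) (relF R)))
  direct-subst σ (φ ∧ ψ)    = cong₂ _∧_ (direct-subst σ φ) (direct-subst σ ψ)
  direct-subst σ (φ ∨ ψ)    = cong₂ _∨_ (direct-subst σ φ) (direct-subst σ ψ)
  direct-subst σ (φ ⇒ ψ)    = cong₂ _⇒_ (direct-subst σ φ) (direct-subst σ ψ)
  direct-subst σ (∀′ φ)     = cong ∀′ (trans (direct-subst (liftS σ) φ) (subst-cong
    (λ { zero → refl ; (suc i) → directT-renameT suc (σ i) }) (direct φ)))
  direct-subst σ (∃′ φ)     = cong ∃′ (trans (direct-subst (liftS σ) φ) (subst-cong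
    (λ { zero → refl ; (suc i) → directT-renameT suc (σ i) }) (direct φ)))

  direct-rename : (ρ : Fin n → Fin m) → ∀ φ → direct (rename ρ φ) ≡ rename ρ (direct φ)
  direct-rename ρ φ = trans (cong direct (rename-as-subst ρ φ))
    (trans (direct-subst (var ∘ ρ) φ) (sym (rename-as-subst ρ (direct φ))))

  direct-[] : ∀ (φ : Formula WDSig (suc n)) t → direct (φ [ t ]) ≡ direct φ [ directT t ]
  direct-[] φ t = trans (direct-subst (t ◂ var) φ)
    (subst-cong (λ { zero → refl ; (suc i) → refl }) (direct φ))

  map-direct-weaken : (Γ : List (Formula WDSig n)) →
                      map direct (map weaken Γ) ≡ map weaken (map direct Γ)
  map-direct-weaken []      = refl
  map-direct-weaken (φ ∷ Γ) = cong₂ _∷_ (direct-rename suc φ) (map-direct-weaken Γ)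

  module _ {T : Theory VWSig} where

    -- As `direct` commutes with instantiation and weakening, every rule is translated into itself
    -- and only the axioms remain to be proved.
    direct-sound : {S : Theory WDSig} →
      (∀ {φ} → S φ → ∀ {n} {Γ : List (Formula VWSig n)} → T ∣ Γ ⊢ direct (rename Vector.[] φ)) →
      ∀ {n Γ} {φ : Formula WDSig n} → S ∣ Γ ⊢ φ → T ∣ map direct Γ ⊢ direct φ
    direct-sound {S} ax = go
      where
      go : ∀ {n Γ} {φ : Formula WDSig n} → S ∣ Γ ⊢ φ → T ∣ map direct Γ ⊢ direct φ
      go (axiom x)       = ax x
      go (hyp x)         = hyp (∈-map⁺ direct x)
      go (raa p)         = raa (go p)
      go (⇒-intro p)     = ⇒-intro (go p)
      go (⇒-elim p q)    = ⇒-elim (go p) (go q)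
      go (∧-intro p q)   = ∧-intro (go p) (go q)
      go (∧-elim₁ p)     = ∧-elim₁ (go p)
      go (∧-elim₂ p)     = ∧-elim₂ (go p)
      go (∨-intro₁ p)    = ∨-intro₁ (go p)
      go (∨-intro₂ p)    = ∨-intro₂ (go p)
      go (∨-elim p q r)  = ∨-elim (go p) (go q) (go r)
      go {Γ = Γ} (∀-intro p) = ∀-intro (≡-subst (T ∣_⊢ _) (map-direct-weaken Γ) (go p))
      go (∀-elim {φ} p t) = cast (sym (direct-[] φ t)) (∀-elim (go p) (directT t))
      go (∃-intro {φ} t p) = ∃-intro (directT t) (cast (direct-[] φ t) (go p))
      go {Γ = Γ} (∃-elim {φ} {χ} p q) = ∃-elim (go p)
        (≡-subst (λ Δ → T ∣ direct φ ∷ Δ ⊢ _) (map-direct-weaken Γ)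
          (cast (direct-rename suc χ) (go q)))
      go ≐-refl          = ≐-refl
      go (≐-subst {t} {u} φ p q) = cast (sym (direct-[] φ u))
        (≐-subst (direct φ) (go p) (cast (direct-[] φ t) (go q)))
      go nonempty        = nonempty

    private
      variable
        Γ : List (Formula VWSig n)

    value⇔ : (y : Fin m) (ρ : Fin n → Fin m) → ∀ t →
             T ∣ Γ ⊢ rename (y ◂ ρ) (value τ t) ⇔ var y ≐ renameT ρ (directT t)
    value⇔ y ρ (var i)           = ⇔-refl
    value⇔ y ρ (fn (const s) []) =
      ∧-intro (⇒-intro (cast eq (∧-elim₂ hyp₀))) (⇒-intro (∧-intro ⊤-intro (cast (sym eq) hyp₀)))
      where
      eq = cong (var y ≐_) (trans (trans (cong (renameT (y ◂ ρ)) (renameT-word _ (code s)))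
             (renameT-word _ (code s))) (sym (renameT-word ρ (code s))))

    -- Stands in for `areValues` while the existential block is instantiated: substitution acts on
    -- these equations directly, whereas `areValues` would call for a substitution law for `value`.
    areEqual : Vec (Term VWSig n) k → (Fin k → Fin n) → Formula VWSig n
    areEqual []       ys = ⊤′
    areEqual (t ∷ ts) ys = var (ys zero) ≐ t ∧ areEqual ts (ys ∘ suc)

    directTs : (Fin n → Fin m) → Vec (Term WDSig n) k → Vec (Term VWSig m) k
    directTs ρ []       = []
    directTs ρ (t ∷ ts) = renameT ρ (directT t) ∷ directTs ρ ts

    lookup-directTs : (ρ : Fin n → Fin m) (ts : Vec (Term WDSig n) k) → ∀ i →
                      lookup (directTs ρ ts) i ≡ renameT ρ (directT (lookup ts i))
    lookup-directTs ρ (t ∷ ts) zero    = refl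
    lookup-directTs ρ (t ∷ ts) (suc i) = lookup-directTs ρ ts i

    areValues⇒ : ∀ (ts : Vec (Term WDSig n) k) (ys : Fin k → Fin m) ρ →
                 T ∣ Γ ⊢ areValues τ ts ys ρ → ∀ i →
                 T ∣ Γ ⊢ var (ys i) ≐ renameT ρ (directT (lookup ts i))
    areValues⇒ (t ∷ ts) ys ρ p zero    = ⇔-to (value⇔ (ys zero) ρ t) (∧-elim₂ (∧-elim₁ p))
    areValues⇒ (t ∷ ts) ys ρ p (suc i) = areValues⇒ ts (ys ∘ suc) ρ (∧-elim₂ p) i

    areValues⇐ : ∀ (ts : Vec (Term WDSig n) k) (ys : Fin k → Fin m) ρ →
                 T ∣ Γ ⊢ areEqual (directTs ρ ts) ys → T ∣ Γ ⊢ areValues τ ts ys ρ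
    areValues⇐ []       ys ρ p = ⊤-intro
    areValues⇐ (t ∷ ts) ys ρ p = ∧-intro
      (∧-intro ⊤-intro (⇔-from (value⇔ (ys zero) ρ t) (∧-elim₁ p)))
      (areValues⇐ ts (ys ∘ suc) ρ (∧-elim₂ p))

    areEqual-intro : (σ : Fin n → Term VWSig m) (ts : Vec (Term VWSig n) k) (ys : Fin k → Fin n) →
                     (∀ i → σ (ys i) ≡ substT σ (lookup ts i)) →
                     T ∣ Γ ⊢ subst σ (areEqual ts ys)
    areEqual-intro σ []       ys eq = ⊤-intro
    areEqual-intro σ (t ∷ ts) ys eq = ∧-intro (cast (cong (_≐ substT σ t) (sym (eq zero))) ≐-refl)
      (areEqual-intro σ ts (ys ∘ suc) (eq ∘ suc))

    withValues⇔ : (ts : Vec (Term WDSig n) k) (φ : Formula VWSig k) →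
                  T ∣ Γ ⊢ withValues τ ts id (rename (_↑ˡ n) φ) ⇔ subst (directT ∘ lookup ts) φ
    withValues⇔ {n} {k} ts φ = ∧-intro
      (⇒-intro (∃^-elim k
        (cast (sym (rename-subst (k ↑ʳ_) (directT ∘ lookup ts) φ))
          (≐-replace φ (areValues⇒ ts (_↑ˡ n) (k ↑ʳ_) (∧-elim₁ hyp₀))
            (cast (rename-as-subst (_↑ˡ n) φ) (∧-elim₂ hyp₀))))
        hyp₀))
      (⇒-intro (∃^-mono k {φ = areEqual (directTs (k ↑ʳ_) ts) (_↑ˡ n) ∧ rename (_↑ˡ n) φ}
        (∧-intro (areValues⇐ ts (_↑ˡ n) (k ↑ʳ_) (∧-elim₁ hyp₀)) (∧-elim₂ hyp₀))
        (∃^-intro k _ values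
          (∧-intro
            (areEqual-intro (extend k values) (directTs (k ↑ʳ_) ts) (_↑ˡ n) (λ i →
              trans (extend-↑ˡ k values i) (sym (trans
                (cong (substT (extend k values)) (lookup-directTs (k ↑ʳ_) ts i))
                (substT-extend-↑ʳ k values (values i))))))
            (cast (sym (trans (subst-rename (extend k values) (_↑ˡ n) φ)
                              (subst-cong (extend-↑ˡ k values) φ)))
              hyp₀)))))
      where
      values : Fin k → Term VWSig n
      values = directT ∘ lookup ts

    translate⇔direct : (φ : Formula WDSig n) → T ∣ Γ ⊢ translate τ φ ⇔ direct φ
    translate⇔direct ⊥′         = ⇔-refl
    translate⇔direct (t ≐ u)    = withValues⇔ (t ∷ u ∷ []) (var zero ≐ var (suc zero))
    translate⇔direct (rel R ts) = withValues⇔ ts (relF R)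
    translate⇔direct (φ ∧ ψ)    = ∧-intro
      (⇒-intro (∧-intro (⇔-to (translate⇔direct φ) (∧-elim₁ hyp₀)) (⇔-to (translate⇔direct ψ) (∧-elim₂ hyp₀))))
      (⇒-intro (∧-intro (⇔-from (translate⇔direct φ) (∧-elim₁ hyp₀)) (⇔-from (translate⇔direct ψ) (∧-elim₂ hyp₀))))
    translate⇔direct (φ ∨ ψ)    = ∧-intro
      (⇒-intro (∨-elim hyp₀ (∨-intro₁ (⇔-to (translate⇔direct φ) hyp₀)) (∨-intro₂ (⇔-to (translate⇔direct ψ) hyp₀))))
      (⇒-intro (∨-elim hyp₀ (∨-intro₁ (⇔-from (translate⇔direct φ) hyp₀)) (∨-intro₂ (⇔-from (translate⇔direct ψ) hyp₀))))
    translate⇔direct (φ ⇒ ψ)    = ∧-intro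
      (⇒-intro (⇒-intro (⇔-to (translate⇔direct ψ) (⇒-elim hyp₁ (⇔-from (translate⇔direct φ) hyp₀)))))
      (⇒-intro (⇒-intro (⇔-from (translate⇔direct ψ) (⇒-elim hyp₁ (⇔-to (translate⇔direct φ) hyp₀)))))
    translate⇔direct (∀′ φ)     = ∧-intro
      (⇒-intro (∀-mono (⇔-to (translate⇔direct φ) (⇒-elim hyp₀ ⊤-intro)) hyp₀))
      (⇒-intro (∀-mono (⇒-intro (⇔-from (translate⇔direct φ) hyp₁)) hyp₀))
    translate⇔direct (∃′ φ)     = ∧-intro
      (⇒-intro (∃-mono (⇔-to (translate⇔direct φ) (∧-elim₂ hyp₀)) hyp₀))
      (⇒-intro (∃-mono (∧-intro ⊤-intro (⇔-from (translate⇔direct φ) hyp₀)) hyp₀))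

  direct-interprets : {T : Theory VWSig} {S : Theory WDSig} →
    (∀ {φ} → S φ → ∀ {n} {Γ : List (Formula VWSig n)} → T ∣ Γ ⊢ direct (rename Vector.[] φ)) →
    T Interprets S
  direct-interprets ax = τ , λ φ p → ⇔-from (translate⇔direct φ) (direct-sound ax p)

-- Prefixes and suffixes of standard words

Prefix Suffix : Σ* → Σ* → Set
Prefix s t = ∃ λ q → s ++ q ≡ t
Suffix s t = ∃ λ r → r ++ s ≡ t

_≟ˡ_ : (d d′ : Letter) → Dec (d ≡ d′)
𝟏 ≟ˡ 𝟏 = yes refl
𝟏 ≟ˡ 𝟐 = no λ ()
𝟐 ≟ˡ 𝟏 = no λ ()
𝟐 ≟ˡ 𝟐 = yes refl

_≟ʷ_ : (s t : Σ*) → Dec (s ≡ t)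
_≟ʷ_ = ≡-dec _≟ˡ_

-- Deciding a bounded quantifier takes either all instances or an explicit counterexample; a finite
-- search supplies one of the two constructively.
prefixes-dichotomy : {A B : Σ* → Set} → (∀ p → A p ⊎ B p) → ∀ w →
                     (∀ p → Prefix p w → A p) ⊎ ∃ λ p → Prefix p w × B p
prefixes-dichotomy f w with f []
prefixes-dichotomy f w        | inj₂ b = inj₂ ([] , (w , refl) , b)
prefixes-dichotomy f []       | inj₁ a = inj₁ λ { [] _ → a }
prefixes-dichotomy f (d ∷ w)  | inj₁ a with prefixes-dichotomy (f ∘ (d ∷_)) w
... | inj₁ all               = inj₁ λ { [] _ → a ; (_ ∷ p) (q , refl) → all p (q , refl) }
... | inj₂ (p , (q , eq) , b) = inj₂ (d ∷ p , (q , cong (d ∷_) eq) , b)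

suffixes-dichotomy : {A B : Σ* → Set} → (∀ p → A p ⊎ B p) → ∀ w →
                     (∀ p → Suffix p w → A p) ⊎ ∃ λ p → Suffix p w × B p
suffixes-dichotomy f w with f w
suffixes-dichotomy f w        | inj₂ b = inj₂ (w , ([] , refl) , b)
suffixes-dichotomy f []       | inj₁ a = inj₁ λ { [] _ → a ; (_ ∷ _) ([] , ()) ; (_ ∷ _) (_ ∷ _ , ()) }
suffixes-dichotomy f (d ∷ w)  | inj₁ a with suffixes-dichotomy f w
... | inj₁ all               = inj₁ λ { p ([] , refl) → a ; p (_ ∷ r , refl) → all p (r , refl) }
... | inj₂ (p , (r , eq) , b) = inj₂ (p , (d ∷ r , cong (d ∷_) eq) , b)

prefix? : ∀ s t → Dec (Prefix s t)
prefix? []      t       = yes (t , refl)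
prefix? (d ∷ s) []      = no λ ()
prefix? (d ∷ s) (d′ ∷ t) with d ≟ˡ d′
... | no d≢d′ = no λ { (_ , eq) → d≢d′ (∷-injectiveˡ eq) }
... | yes refl = map′ (λ { (q , eq) → q , cong (d ∷_) eq }) (λ { (q , refl) → q , refl }) (prefix? s t)

suffix? : ∀ s t → Dec (Suffix s t)
suffix? s t with s ≟ʷ t
suffix? s t        | yes refl = yes ([] , refl)
suffix? s []       | no s≢[]  = no λ { ([] , refl) → s≢[] refl }
suffix? s (d ∷ t)  | no s≢d∷t with suffix? s t
... | yes (r , eq) = yes (d ∷ r , cong (d ∷_) eq)
... | no ¬suffix   = no λ { ([] , eq) → s≢d∷t eq ; (_ ∷ r , refl) → ¬suffix (r , refl) }

-- Derivations about canonical terms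

private
  variable
    Γ       : List (Formula VWSig n)
    φ       : Formula VWSig n
    t t′ u u′ : Term VWSig n

word-∷ʳ : ∀ w d → word {n} (w ∷ʳ d) ≡ append d (word w)
word-∷ʳ w d = foldl-∷ʳ (λ t d → append d t) ε d w

VW-axiom : ∀ {φ : Sentence VWSig} {ψ : Formula VWSig n} → VW* φ → rename Vector.[] φ ≡ ψ → VW* ∣ Γ ⊢ ψ
VW-axiom ax eq = cast eq (axiom ax)

word-≢ : ∀ {s t} → s ≢ t → VW* ∣ Γ ⊢ ¬′ (word s ≐ word t)
word-≢ {s = s} {t} s≢t =
  VW-axiom (vw1 s t s≢t) (cong₂ (λ t u → ¬′ (t ≐ u)) (renameT-word _ s) (renameT-word _ t))

prepend-word : ∀ d w → VW* ∣ Γ ⊢ prepend d (word w) ≐ word (d ∷ w)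
prepend-word 𝟏 w = VW-axiom (vw2* 𝟏 w)
  (cong₂ _≐_ (cong (prepend 𝟏) (renameT-word _ w)) (renameT-word _ (𝟏 ∷ w)))
prepend-word 𝟐 w = VW-axiom (vw2* 𝟐 w)
  (cong₂ _≐_ (cong (prepend 𝟐) (renameT-word _ w)) (renameT-word _ (𝟐 ∷ w)))

-- Both order axioms, (VW5) and (VW5*), describe the words below a nonempty
-- word w in terms of the words below the word w′ obtained by deleting a letter.
Unfolding : VWRel 2 → Σ* → Σ* → Formula VWSig n
Unfolding Q w w′ =
  ∀′ (rel Q (var zero ∷ word w ∷ []) ⇔ rel Q (var zero ∷ word w′ ∷ []) ∨ var zero ≐ word w)

⊑-unfolding : ∀ w d → VW* ∣ Γ ⊢ Unfolding ⊑-sym (w ∷ʳ d) w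
⊑-unfolding w d = VW-axiom (vw5 d w) (cong ∀′ (cong₂ (λ t u → var zero ⊑ t ⇔ var zero ⊑ u ∨ var zero ≐ t)
  (trans (cong (renameT _) (sym (word-∷ʳ w d))) (renameT-word _ (w ∷ʳ d)))
  (renameT-word _ w)))

-- (VW5*) speaks of `prepend d (word w)`, which is only provably equal to the canonical term
-- `word (d ∷ w)`, so (VW2*) has to transport it. In the case of `append` the two terms coincide.
⊒-unfolding : ∀ d w → VW* ∣ Γ ⊢ Unfolding ⊒-sym (d ∷ w) w
⊒-unfolding {n} {Γ} d w = cast (instantiated _ (renameT-word suc (d ∷ w)))
  (≐-subst χ (prepend-word d w) (cast (sym (instantiated (prepend d (word w)) (renamed suc d)))
    (VW-axiom (vw5* d w) (cong ∀′ (cong₂ (λ t u → var zero ⊒ t ⇔ var zero ⊒ u ∨ var zero ≐ t)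
      (renamed (liftR Vector.[]) d) (renameT-word _ w))))))
  where
  χ : Formula VWSig (suc n)
  χ = ∀′ (var zero ⊒ var (suc zero) ⇔ var zero ⊒ word w ∨ var zero ≐ var (suc zero))

  renamed : ∀ {m o} (ρ : Fin m → Fin o) d → renameT ρ (prepend d (word w)) ≡ prepend d (word w)
  renamed ρ 𝟏 = cong (prepend 𝟏) (renameT-word ρ w)
  renamed ρ 𝟐 = cong (prepend 𝟐) (renameT-word ρ w)

  instantiated : ∀ t {u} → renameT suc t ≡ u →
                 χ [ t ] ≡ ∀′ (var zero ⊒ u ⇔ var zero ⊒ word w ∨ var zero ≐ u)
  instantiated t eq = cong ∀′ (cong₂ (λ u v → var zero ⊒ u ⇔ var zero ⊒ v ∨ var zero ≐ u)
    eq (substT-word (liftS (t ◂ var)) w))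

unfold : ∀ {Q} w w′ → VW* ∣ Γ ⊢ Unfolding Q w w′ → ∀ t →
         VW* ∣ Γ ⊢ rel Q (t ∷ word w ∷ []) ⇔ rel Q (t ∷ word w′ ∷ []) ∨ t ≐ word w
unfold {Q = Q} w w′ p t = cast
  (cong₂ (λ u v → rel Q (t ∷ u ∷ []) ⇔ rel Q (t ∷ v ∷ []) ∨ t ≐ u) (substT-word _ w) (substT-word _ w′))
  (∀-elim p t)

Bounded : VWRel 2 → Term VWSig n → Formula VWSig (suc n) → Formula VWSig n
Bounded Q t φ = ∀′ (rel Q (var zero ∷ renameT suc t ∷ []) ⇒ φ)

substitute-word : ∀ w {Γ : List (Formula VWSig (suc n))} {φ} → VW* ∣ Γ ⊢ var zero ≐ word w →
                  VW* ∣ Γ ⊢ weaken (φ [ word w ]) → VW* ∣ Γ ⊢ φ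
substitute-word w {φ = φ} p q = cast (liftR-suc-[] φ)
  (≐-subst (rename (liftR suc) φ) (≐-sym p) (cast eq q))
  where
  eq : weaken (φ [ word w ]) ≡ rename (liftR suc) φ [ word w ]
  eq = trans (rename-subst suc _ φ) (trans
    (subst-cong (λ { zero → renameT-word suc w ; (suc i) → refl }) φ)
    (sym (subst-rename _ (liftR suc) φ)))

∀-elim-weakened : ∀ {T : Theory L} {Γ : List (Formula L (suc n))} {φ} → T ∣ Γ ⊢ weaken (∀′ φ) → T ∣ Γ ⊢ φ
∀-elim-weakened {φ = φ} p = cast (liftR-suc-[] φ) (∀-elim p (var zero))

bounded-word : ∀ {Q} w (φ : Formula VWSig (suc n)) →
  Bounded Q (word w) φ ≡ ∀′ (rel Q (var zero ∷ word w ∷ []) ⇒ φ)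
bounded-word {Q = Q} w φ = cong (λ t → ∀′ (rel Q (var zero ∷ t ∷ []) ⇒ φ)) (renameT-word suc w)

bounded-[] : ∀ {Q} → VW* ∣ Γ ⊢ ∀′ (rel Q (var zero ∷ ε ∷ []) ⇒ var zero ≐ ε) →
             VW* ∣ Γ ⊢ φ [ ε ] → VW* ∣ Γ ⊢ Bounded Q ε φ
bounded-[] p q = ⇒-elim (⇒-elim (⇒-intro (⇒-intro (∀-intro (⇒-intro
    (substitute-word [] (⇒-elim (∀-elim-weakened hyp₂) hyp₀) hyp₁))))) p) q

-- The unfolding leaves two cases for the bound variable: it lies below `w′`, where the given
-- bounded statement applies, or it equals `w`.
bounded-step : ∀ {Q} w w′ → VW* ∣ Γ ⊢ Unfolding Q w w′ → VW* ∣ Γ ⊢ φ [ word w ] →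
               VW* ∣ Γ ⊢ Bounded Q (word w′) φ → VW* ∣ Γ ⊢ Bounded Q (word w) φ
bounded-step {φ = φ} w w′ p q r = cast (sym (bounded-word w φ))
  (⇒-elim (⇒-elim (⇒-elim (⇒-intro (⇒-intro (⇒-intro (∀-intro (⇒-intro
    (∨-elim (⇔-to (∀-elim-weakened (wk hyp₂)) hyp₀)
      (⇒-elim (∀-elim-weakened hyp₂) hyp₀)
      (substitute-word w hyp₀ (wk hyp₂)))))))) p) q) (cast (bounded-word w′ φ) r))

-- Induction on the standard word outside the theory reduces the internal quantifier to finitely
-- many instances. (VW5) removes letters at the right end, hence the reversed view of `w`.
bounded-⊑ : ∀ w → (∀ p → Prefix p w → VW* ∣ Γ ⊢ φ [ word p ]) → VW* ∣ Γ ⊢ Bounded ⊑-sym (word w) φ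
bounded-⊑ {Γ = Γ} {φ = φ} w = go (reverseView w)
  where
  go : ∀ {w} → Reverse w → (∀ p → Prefix p w → VW* ∣ Γ ⊢ φ [ word p ]) →
       VW* ∣ Γ ⊢ Bounded ⊑-sym (word w) φ
  go []            f = bounded-[] (VW-axiom vw4 refl) (f [] ([] , refl))
  go (w ∶ rs ∶ʳ d) f = bounded-step (w ∷ʳ d) w (⊑-unfolding w d) (f (w ∷ʳ d) ([] , ++-identityʳ _))
    (go rs λ { p (q , refl) → f p (q ∷ʳ d , sym (++-assoc p q (d ∷ []))) })

bounded-⊒ : ∀ w → (∀ s → Suffix s w → VW* ∣ Γ ⊢ φ [ word s ]) → VW* ∣ Γ ⊢ Bounded ⊒-sym (word w) φ
bounded-⊒ []      f = bounded-[] (VW-axiom vw4* refl) (f [] ([] , refl))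
bounded-⊒ (d ∷ w) f = bounded-step (d ∷ w) w (⊒-unfolding d w) (f (d ∷ w) ([] , refl))
  (bounded-⊒ w λ { s (r , refl) → f s (d ∷ r , refl) })

bounded-≐ : ∀ {Q} → VW* ∣ Γ ⊢ t ≐ u → VW* ∣ Γ ⊢ Bounded Q u φ → VW* ∣ Γ ⊢ Bounded Q t φ
bounded-≐ {t = t} {u} {φ = φ} {Q = Q} p q =
  cast (instantiated t) (≐-subst χ (≐-sym p) (cast (sym (instantiated u)) q))
  where
  χ = ∀′ (rel Q (var zero ∷ var (suc zero) ∷ []) ⇒ rename (liftR suc) φ)

  instantiated : ∀ t → χ [ t ] ≡ Bounded Q t φ
  instantiated t = cong (λ ψ → ∀′ (rel Q (var zero ∷ renameT suc t ∷ []) ⇒ ψ))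
    (trans (subst-rename _ (liftR suc) φ)
      (trans (subst-cong (λ { zero → refl ; (suc i) → refl }) φ) (subst-var φ)))

⊑-refl : ∀ w → VW* ∣ Γ ⊢ word w ⊑ word w
⊑-refl w with reverseView w
... | []           = VW-axiom (vw3 []) refl
... | w′ ∶ _ ∶ʳ d  = ⇔-from (unfold (w′ ∷ʳ d) w′ (⊑-unfolding w′ d) (word (w′ ∷ʳ d))) (∨-intro₂ ≐-refl)

-- (VW5) lengthens the upper word at its right end, so `q` is fed letter by letter into the
-- accumulator `r`.
prefix-⊑ : ∀ p q → VW* ∣ Γ ⊢ word p ⊑ word (p ++ q)
prefix-⊑ {Γ = Γ} p q = cast (cong (λ r → word p ⊑ word (r ++ q)) (++-identityʳ p)) (go [] q base)
  where
  base : VW* ∣ Γ ⊢ word p ⊑ word (p ++ [])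
  base = cast (cong (λ r → word p ⊑ word r) (sym (++-identityʳ p))) (⊑-refl p)

  go : ∀ r q → VW* ∣ Γ ⊢ word p ⊑ word (p ++ r) → VW* ∣ Γ ⊢ word p ⊑ word ((p ++ r) ++ q)
  go r []      h = cast (cong (λ s → word p ⊑ word s) (sym (++-identityʳ (p ++ r)))) h
  go r (d ∷ q) h = cast
    (cong (λ s → word p ⊑ word s) (trans (cong (_++ q) (sym (++-assoc p r (d ∷ [])))) (++-assoc (p ++ r) (d ∷ []) q)))
    (go (r ∷ʳ d) q (cast (cong (λ s → word p ⊑ word s) (++-assoc p r (d ∷ [])))
      (⇔-from (unfold ((p ++ r) ∷ʳ d) (p ++ r) (⊑-unfolding (p ++ r) d) (word p)) (∨-intro₁ h))))

suffix-⊒ : ∀ r s → VW* ∣ Γ ⊢ word s ⊒ word (r ++ s)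
suffix-⊒ []      []      = VW-axiom (vw3* []) refl
suffix-⊒ []      (d ∷ s) = ⇔-from (unfold (d ∷ s) s (⊒-unfolding d s) (word (d ∷ s))) (∨-intro₂ ≐-refl)
suffix-⊒ (d ∷ r) s       = ⇔-from (unfold (d ∷ r ++ s) (r ++ s) (⊒-unfolding d (r ++ s)) (word s)) (∨-intro₁ (suffix-⊒ r s))

-- Truth is recorded along with provability, so that a true formula gets its proof without any
-- appeal to the consistency of the theory.
Decided : {n : ℕ} → List (Formula VWSig n) → Set → Formula VWSig n → Set
Decided Γ P φ = (P × VW* ∣ Γ ⊢ φ) ⊎ (¬ P × VW* ∣ Γ ⊢ ¬′ φ)

-- If everything below `w` differs from `s`, then `s` below `w` would differ from itself.
refute-bounded : ∀ Q s w → VW* ∣ Γ ⊢ Bounded Q (word w) (¬′ (word s ≐ var zero)) →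
                 VW* ∣ Γ ⊢ ¬′ rel Q (word s ∷ word w ∷ [])
refute-bounded Q s w p = ⇒-intro (⇒-elim (⇒-elim (wk p′) hyp₀) ≐-refl)
  where
  p′ = cast (cong₂ (λ t u → rel Q (word s ∷ t ∷ []) ⇒ ¬′ (u ≐ word s))
         (substT-weaken (word s) (word w)) (substT-word (word s ◂ var) s)) (∀-elim p (word s))

distinct-instance : ∀ s p → s ≢ p → VW* ∣ Γ ⊢ (¬′ (word s ≐ var zero)) [ word p ]
distinct-instance s p s≢p =
  cast (cong (λ t → ¬′ (t ≐ word p)) (sym (substT-word (word p ◂ var) s))) (word-≢ s≢p)

decide-≐ : ∀ s t → Decided Γ (s ≡ t) (word s ≐ word t)
decide-≐ s t with s ≟ʷ t
... | yes refl = inj₁ (refl , ≐-refl)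
... | no s≢t   = inj₂ (s≢t , word-≢ s≢t)

decide-⊑ : ∀ s t → Decided Γ (Prefix s t) (word s ⊑ word t)
decide-⊑ s t with prefix? s t
... | yes (q , refl) = inj₁ ((q , refl) , prefix-⊑ s q)
... | no ¬prefix     = inj₂ (¬prefix , refute-bounded ⊑-sym s t
  (bounded-⊑ t λ p p⊑t → distinct-instance s p λ { refl → ¬prefix p⊑t }))

decide-⊒ : ∀ s t → Decided Γ (Suffix s t) (word s ⊒ word t)
decide-⊒ s t with suffix? s t
... | yes (r , refl) = inj₁ ((r , refl) , suffix-⊒ r s)
... | no ¬suffix     = inj₂ (¬suffix , refute-bounded ⊒-sym s t
  (bounded-⊒ t λ p p⊒t → distinct-instance s p λ { refl → ¬suffix p⊒t }))

decided-replace : ∀ {P} (φ : Formula VWSig 2) → VW* ∣ Γ ⊢ t ≐ t′ → VW* ∣ Γ ⊢ u ≐ u′ →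
  Decided Γ P (subst (t′ ◂ u′ ◂ Vector.[]) φ) → Decided Γ P (subst (t ◂ u ◂ Vector.[]) φ)
decided-replace φ p q (inj₁ (x , r)) = inj₁ (x , ≐-replace₂ φ (≐-sym p) (≐-sym q) r)
decided-replace φ p q (inj₂ (x , r)) = inj₂ (x , ≐-replace₂ (¬′ φ) (≐-sym p) (≐-sym q) r)

-- Bounded formulas

Env : ℕ → Set
Env n = Fin n → Σ*

⟦_⟧ᵗ : Term VWSig n → Env n → Σ*
⟦ var i ⟧ᵗ           e = e i
⟦ fn e-sym [] ⟧ᵗ     e = []
⟦ fn S₁ (t ∷ []) ⟧ᵗ  e = ⟦ t ⟧ᵗ e ∷ʳ 𝟏
⟦ fn S₂ (t ∷ []) ⟧ᵗ  e = ⟦ t ⟧ᵗ e ∷ʳ 𝟐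
⟦ fn S₃ (t ∷ []) ⟧ᵗ  e = 𝟏 ∷ ⟦ t ⟧ᵗ e
⟦ fn S₄ (t ∷ []) ⟧ᵗ  e = 𝟐 ∷ ⟦ t ⟧ᵗ e

infix  9 _≐₀_ _⊑₀_ _⊒₀_
infixr 8 _∧₀_
infixr 6 _⇒₀_

-- With `at` as a constructor, substitution is delayed: its truth condition just changes the
-- environment, and no substitution lemma for truth is required.
data Δ₀ (n : ℕ) : Set where
  ⊥₀             : Δ₀ n
  _≐₀_ _⊑₀_ _⊒₀_ : Term VWSig n → Term VWSig n → Δ₀ n
  _∧₀_ _⇒₀_      : Δ₀ n → Δ₀ n → Δ₀ n
  ∀⊑ ∀⊒          : Fin n → Δ₀ (suc n) → Δ₀ n
  at             : (Fin m → Term VWSig n) → Δ₀ m → Δ₀ n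

¬₀_ : Δ₀ n → Δ₀ n
¬₀ δ = δ ⇒₀ ⊥₀

⌜_⌝ : Δ₀ n → Formula VWSig n
⌜ ⊥₀ ⌝     = ⊥′
⌜ t ≐₀ u ⌝ = t ≐ u
⌜ t ⊑₀ u ⌝ = t ⊑ u
⌜ t ⊒₀ u ⌝ = t ⊒ u
⌜ δ ∧₀ δ′ ⌝ = ⌜ δ ⌝ ∧ ⌜ δ′ ⌝
⌜ δ ⇒₀ δ′ ⌝ = ⌜ δ ⌝ ⇒ ⌜ δ′ ⌝
⌜ ∀⊑ i δ ⌝ = Bounded ⊑-sym (var i) ⌜ δ ⌝
⌜ ∀⊒ i δ ⌝ = Bounded ⊒-sym (var i) ⌜ δ ⌝
⌜ at σ δ ⌝ = subst σ ⌜ δ ⌝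

⟦_⟧ : Δ₀ n → Env n → Set
⟦ ⊥₀ ⟧      e = ⊥
⟦ t ≐₀ u ⟧  e = ⟦ t ⟧ᵗ e ≡ ⟦ u ⟧ᵗ e
⟦ t ⊑₀ u ⟧  e = Prefix (⟦ t ⟧ᵗ e) (⟦ u ⟧ᵗ e)
⟦ t ⊒₀ u ⟧  e = Suffix (⟦ t ⟧ᵗ e) (⟦ u ⟧ᵗ e)
⟦ δ ∧₀ δ′ ⟧ e = ⟦ δ ⟧ e × ⟦ δ′ ⟧ e
⟦ δ ⇒₀ δ′ ⟧ e = ⟦ δ ⟧ e → ⟦ δ′ ⟧ e
⟦ ∀⊑ i δ ⟧  e = ∀ p → Prefix p (e i) → ⟦ δ ⟧ (p ◂ e)
⟦ ∀⊒ i δ ⟧  e = ∀ s → Suffix s (e i) → ⟦ δ ⟧ (s ◂ e)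
⟦ at σ δ ⟧  e = ⟦ δ ⟧ (λ i → ⟦ σ i ⟧ᵗ e)

evaluate : (σ : Fin n → Term VWSig m) (e : Env n) → (∀ i → VW* ∣ Γ ⊢ σ i ≐ word (e i)) →
           ∀ t → VW* ∣ Γ ⊢ substT σ t ≐ word (⟦ t ⟧ᵗ e)
evaluate {Γ = Γ} σ e eq = go
  where
  appended : ∀ d w {t} → VW* ∣ Γ ⊢ t ≐ append d (word w) → VW* ∣ Γ ⊢ t ≐ word (w ∷ʳ d)
  appended d w = cast (cong (_ ≐_) (sym (word-∷ʳ w d)))

  go : ∀ t → VW* ∣ Γ ⊢ substT σ t ≐ word (⟦ t ⟧ᵗ e)
  go (var i)           = eq i
  go (fn e-sym [])     = ≐-refl
  go (fn S₁ (t ∷ []))  = appended 𝟏 (⟦ t ⟧ᵗ e) (≐-cong₁ S₁ (go t))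
  go (fn S₂ (t ∷ []))  = appended 𝟐 (⟦ t ⟧ᵗ e) (≐-cong₁ S₂ (go t))
  go (fn S₃ (t ∷ []))  = ≐-trans (≐-cong₁ S₃ (go t)) (prepend-word 𝟏 (⟦ t ⟧ᵗ e))
  go (fn S₄ (t ∷ []))  = ≐-trans (≐-cong₁ S₄ (go t)) (prepend-word 𝟐 (⟦ t ⟧ᵗ e))

∀-refute : (σ : Fin n → Term VWSig m) (e : Env n) (i : Fin n) (Q : VWRel 2)
           (φ : Formula VWSig (suc n)) (p : Σ*) → VW* ∣ Γ ⊢ σ i ≐ word (e i) →
           VW* ∣ Γ ⊢ rel Q (word p ∷ word (e i) ∷ []) → VW* ∣ Γ ⊢ ¬′ subst (word p ◂ σ) φ →
           VW* ∣ Γ ⊢ ¬′ subst σ (Bounded Q (var i) φ)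
∀-refute σ e i Q φ p eq r ¬φ = ⇒-intro (⇒-elim (wk ¬φ) (⇒-elim
  (∀-elim-liftS σ (rel Q (var zero ∷ var (suc i) ∷ []) ⇒ φ) (word p) hyp₀)
  (wk (≐-replace₂ (rel Q (var zero ∷ var (suc zero) ∷ [])) ≐-refl (≐-sym eq) r))))

-- Induction on `δ`. A bounded quantifier is searched at the standard word that its bound equals: if
-- all instances are proved, `bounded-⊑` or `bounded-⊒` collects them, and otherwise one refuted
-- instance refutes the whole. Allowing any terms provably equal to standard words lets the case of
-- `at` go through.
decide : {Γ : List (Formula VWSig m)} (δ : Δ₀ n) (σ : Fin n → Term VWSig m) (e : Env n) →
         (∀ i → VW* ∣ Γ ⊢ σ i ≐ word (e i)) → Decided Γ (⟦ δ ⟧ e) (subst σ ⌜ δ ⌝)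
decide ⊥₀ σ e eq = inj₂ (id , ⇒-intro hyp₀)
decide (t ≐₀ u) σ e eq = decided-replace (var zero ≐ var (suc zero))
  (evaluate σ e eq t) (evaluate σ e eq u) (decide-≐ (⟦ t ⟧ᵗ e) (⟦ u ⟧ᵗ e))
decide (t ⊑₀ u) σ e eq = decided-replace (var zero ⊑ var (suc zero))
  (evaluate σ e eq t) (evaluate σ e eq u) (decide-⊑ (⟦ t ⟧ᵗ e) (⟦ u ⟧ᵗ e))
decide (t ⊒₀ u) σ e eq = decided-replace (var zero ⊒ var (suc zero))
  (evaluate σ e eq t) (evaluate σ e eq u) (decide-⊒ (⟦ t ⟧ᵗ e) (⟦ u ⟧ᵗ e))
decide (δ ∧₀ δ′) σ e eq with decide δ σ e eq | decide δ′ σ e eq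
... | inj₁ (x , p)  | inj₁ (y , q)  = inj₁ ((x , y) , ∧-intro p q)
... | inj₂ (¬x , p) | _             = inj₂ ((λ { (x , _) → ¬x x }) , ⇒-intro (⇒-elim (wk p) (∧-elim₁ hyp₀)))
... | inj₁ _        | inj₂ (¬y , q) = inj₂ ((λ { (_ , y) → ¬y y }) , ⇒-intro (⇒-elim (wk q) (∧-elim₂ hyp₀)))
decide (δ ⇒₀ δ′) σ e eq with decide δ σ e eq | decide δ′ σ e eq
... | _             | inj₁ (y , q)  = inj₁ ((λ _ → y) , ⇒-intro (wk q))
... | inj₂ (¬x , p) | inj₂ _        = inj₁ ((λ x → contradiction x ¬x) , ⇒-intro (ex-falso (⇒-elim (wk p) hyp₀)))
... | inj₁ (x , p)  | inj₂ (¬y , q) = inj₂ ((λ f → ¬y (f x)) , ⇒-intro (⇒-elim (wk q) (⇒-elim hyp₀ (wk p))))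
decide (∀⊑ i δ) σ e eq with
  prefixes-dichotomy (λ p → decide δ (word p ◂ σ) (p ◂ e) λ { zero → ≐-refl ; (suc j) → eq j }) (e i)
... | inj₁ all = inj₁ ((λ p below → proj₁ (all p below)) , bounded-≐ (eq i) (bounded-⊑ (e i) λ p below →
        cast (sym (liftS-[] σ ⌜ δ ⌝ (word p))) (proj₂ (all p below))))
... | inj₂ (p , (q , q≡) , ¬x , r) = inj₂ ((λ f → ¬x (f p (q , q≡))) ,
        ∀-refute σ e i ⊑-sym ⌜ δ ⌝ p (eq i) (cast (cong (λ w → word p ⊑ word w) q≡) (prefix-⊑ p q)) r)
decide (∀⊒ i δ) σ e eq with
  suffixes-dichotomy (λ p → decide δ (word p ◂ σ) (p ◂ e) λ { zero → ≐-refl ; (suc j) → eq j }) (e i)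
... | inj₁ all = inj₁ ((λ p below → proj₁ (all p below)) , bounded-≐ (eq i) (bounded-⊒ (e i) λ p below →
        cast (sym (liftS-[] σ ⌜ δ ⌝ (word p))) (proj₂ (all p below))))
... | inj₂ (p , (q , q≡) , ¬x , r) = inj₂ ((λ f → ¬x (f p (q , q≡))) ,
        ∀-refute σ e i ⊒-sym ⌜ δ ⌝ p (eq i) (cast (cong (λ w → word p ⊒ word w) q≡) (suffix-⊒ q p)) r)
decide (at τ δ) σ e eq with decide δ (substT σ ∘ τ) (λ i → ⟦ τ i ⟧ᵗ e) (λ i → evaluate σ e eq (τ i))
... | inj₁ (x , p) = inj₁ (x , cast (sym (subst-subst σ τ ⌜ δ ⌝)) p)
... | inj₂ (x , p) = inj₂ (x , cast (cong ¬′_ (sym (subst-subst σ τ ⌜ δ ⌝))) p)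

-- Words coding finite relations

-- A number k becomes k letters 2 closed by a 1: the codes 1 and 21 of the bits and the markers 221
-- and 2221 are the numbers 0, 1, 2, 3.
unparse : List ℕ → Σ*
unparse []       = []
unparse (k ∷ ks) = replicate k 𝟐 ++ 𝟏 ∷ unparse ks

-- The counter holds the letters 2 read since the last 1; an unfinished final run of 2's is dropped.
parse : ℕ → Σ* → List ℕ
parse k []      = []
parse k (𝟏 ∷ w) = k ∷ parse zero w
parse k (𝟐 ∷ w) = parse (suc k) w

unparse-++ : ∀ ks ls → unparse (ks ++ ls) ≡ unparse ks ++ unparse ls
unparse-++ []       ls = refl
unparse-++ (k ∷ ks) ls = trans (cong (λ w → replicate k 𝟐 ++ 𝟏 ∷ w) (unparse-++ ks ls))
  (sym (++-assoc (replicate k 𝟐) (𝟏 ∷ unparse ks) (unparse ls)))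

parse-replicate : ∀ j k w → parse j (replicate k 𝟐 ++ 𝟏 ∷ w) ≡ k + j ∷ parse zero w
parse-replicate j zero    w = refl
parse-replicate j (suc k) w = trans (parse-replicate (suc j) k w) (cong (_∷ parse zero w) (+-suc k j))

parse-unparse-++ : ∀ ks w → parse zero (unparse ks ++ w) ≡ ks ++ parse zero w
parse-unparse-++ []       w = refl
parse-unparse-++ (k ∷ ks) w = begin
  parse 0 ((replicate k 𝟐 ++ 𝟏 ∷ unparse ks) ++ w)  ≡⟨ cong (parse 0) (++-assoc (replicate k 𝟐) _ w) ⟩
  parse 0 (replicate k 𝟐 ++ 𝟏 ∷ unparse ks ++ w)    ≡⟨ parse-replicate 0 k _ ⟩
  k + 0 ∷ parse 0 (unparse ks ++ w)                 ≡⟨ cong₂ _∷_ (+-identityʳ k) (parse-unparse-++ ks w) ⟩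
  k ∷ ks ++ parse 0 w                               ∎
  where open ≡-Reasoning

parse-unparse : ∀ ks → parse zero (unparse ks) ≡ ks
parse-unparse ks = trans (cong (parse zero) (sym (++-identityʳ (unparse ks))))
  (trans (parse-unparse-++ ks []) (++-identityʳ ks))

-- The letter 1 resets the counter, so a word may be cut there.
parse-++ : ∀ k r w → parse k (r ++ 𝟏 ∷ w) ≡ parse k (r ∷ʳ 𝟏) ++ parse zero w
parse-++ k []      w = refl
parse-++ k (𝟏 ∷ r) w = cong (k ∷_) (parse-++ zero r w)
parse-++ k (𝟐 ∷ r) w = parse-++ (suc k) r w

replicate-++-∷ : ∀ k (w : Σ*) → replicate k 𝟐 ++ 𝟐 ∷ w ≡ 𝟐 ∷ replicate k 𝟐 ++ w
replicate-++-∷ zero    w = refl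
replicate-++-∷ (suc k) w = cong (𝟐 ∷_) (replicate-++-∷ k w)

unparse-parse : ∀ k r → unparse (parse k (r ∷ʳ 𝟏)) ≡ replicate k 𝟐 ++ (r ∷ʳ 𝟏)
unparse-parse k []      = refl
unparse-parse k (𝟏 ∷ r) = cong (λ w → replicate k 𝟐 ++ 𝟏 ∷ w) (unparse-parse zero r)
unparse-parse k (𝟐 ∷ r) = trans (unparse-parse (suc k) r) (sym (replicate-++-∷ k (r ∷ʳ 𝟏)))

-- Applied to `𝟏 ∷ w`, this expresses without a disjunction that `w` is empty or ends in 1, that is,
-- breaks off between two numbers.
EndsInOne : Σ* → Set
EndsInOne = Suffix (𝟏 ∷ [])

∷-endsInOne : ∀ d {w} → EndsInOne w → EndsInOne (d ∷ w)
∷-endsInOne d (r , eq) = d ∷ r , cong (d ∷_) eq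

unparse-endsInOne : ∀ ks → EndsInOne (𝟏 ∷ unparse ks)
unparse-endsInOne []       = [] , refl
unparse-endsInOne (k ∷ ks) with unparse-endsInOne ks
... | r , eq = 𝟏 ∷ replicate k 𝟐 ++ r ,
  cong (𝟏 ∷_) (trans (++-assoc (replicate k 𝟐) r _) (cong (replicate k 𝟐 ++_) eq))

-- Bits are coded by the numbers 0 and 1; 2 and 3 serve as markers.
digit : Bit → ℕ
digit 𝟘 = 0
digit 𝟙 = 1

digits : List Bit → List ℕ
digits = map digit

encode : List Bit → Σ*
encode bs = unparse (digits bs)

encode-++ : ∀ bs cs → encode (bs ++ cs) ≡ encode bs ++ encode cs
encode-++ bs cs = trans (cong unparse (map-++ digit bs cs)) (unparse-++ (digits bs) (digits cs))

digits-injective : ∀ {bs cs} → digits bs ≡ digits cs → bs ≡ cs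
digits-injective {[]}     {[]}     eq = refl
digits-injective {𝟘 ∷ bs} {𝟘 ∷ cs} eq = cong (𝟘 ∷_) (digits-injective (∷-injectiveʳ eq))
digits-injective {𝟙 ∷ bs} {𝟙 ∷ cs} eq = cong (𝟙 ∷_) (digits-injective (∷-injectiveʳ eq))
digits-injective {𝟘 ∷ bs} {𝟙 ∷ cs} ()
digits-injective {𝟙 ∷ bs} {𝟘 ∷ cs} ()

encode-injective : ∀ {bs cs} → encode bs ≡ encode cs → bs ≡ cs
encode-injective {bs} {cs} eq = digits-injective
  (trans (sym (parse-unparse (digits bs))) (trans (cong (parse zero) eq) (parse-unparse (digits cs))))

-- A prefix that cuts through a bit cuts 21 and ends in 2, which the last hypothesis excludes.
prefix-of-encode : ∀ w bs → Prefix w (encode bs) → EndsInOne (𝟏 ∷ w) →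
                   ∃₂ λ cs ds → cs ++ ds ≡ bs × w ≡ encode cs
prefix-of-encode []          bs       _        _                = [] , bs , refl , refl
prefix-of-encode (d ∷ w)     bs       pre      ([] , ())
prefix-of-encode (d ∷ w)     []       (_ , ()) _
prefix-of-encode (𝟏 ∷ w)     (𝟘 ∷ bs) (q , eq) (_ ∷ r , eq′)
  with prefix-of-encode w bs (q , ∷-injectiveʳ eq) (r , ∷-injectiveʳ eq′)
... | cs , ds , refl , refl = 𝟘 ∷ cs , ds , refl , refl
prefix-of-encode (𝟐 ∷ w)     (𝟘 ∷ bs) (q , ()) _
prefix-of-encode (𝟏 ∷ w)     (𝟙 ∷ bs) (q , ()) _
prefix-of-encode (𝟐 ∷ [])    (𝟙 ∷ bs) _        (_ ∷ [] , ())
prefix-of-encode (𝟐 ∷ [])    (𝟙 ∷ bs) _        (_ ∷ _ ∷ [] , ())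
prefix-of-encode (𝟐 ∷ [])    (𝟙 ∷ bs) _        (_ ∷ _ ∷ _ ∷ _ , ())
prefix-of-encode (𝟐 ∷ 𝟐 ∷ w) (𝟙 ∷ bs) (q , ()) _
prefix-of-encode (𝟐 ∷ 𝟏 ∷ w) (𝟙 ∷ bs) _        (_ ∷ [] , ())
prefix-of-encode (𝟐 ∷ 𝟏 ∷ w) (𝟙 ∷ bs) (q , eq) (_ ∷ _ ∷ r , eq′)
  with prefix-of-encode w bs (q , ∷-injectiveʳ (∷-injectiveʳ eq)) (r , ∷-injectiveʳ (∷-injectiveʳ eq′))
... | cs , ds , refl , refl = 𝟙 ∷ cs , ds , refl , refl

-- Unique readability of lists of blocks

split-at-marker : ∀ bs cs k {ks ls} → digits bs ++ 2 + k ∷ ks ≡ digits cs ++ 2 + k ∷ ls → bs ≡ cs × ks ≡ ls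
split-at-marker []       []       k eq = refl , ∷-injectiveʳ eq
split-at-marker (𝟘 ∷ bs) (𝟘 ∷ cs) k eq with split-at-marker bs cs k (∷-injectiveʳ eq)
... | refl , eq′ = refl , eq′
split-at-marker (𝟙 ∷ bs) (𝟙 ∷ cs) k eq with split-at-marker bs cs k (∷-injectiveʳ eq)
... | refl , eq′ = refl , eq′
split-at-marker []       (𝟘 ∷ _)  k ()
split-at-marker []       (𝟙 ∷ _)  k ()
split-at-marker (𝟘 ∷ _)  []       k ()
split-at-marker (𝟙 ∷ _)  []       k ()
split-at-marker (𝟘 ∷ _)  (𝟙 ∷ _)  k ()
split-at-marker (𝟙 ∷ _)  (𝟘 ∷ _)  k ()

-- Digits are less than 2, so the marker cannot fall among them and whatever precedes it includes
-- them all.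
drop-digits : ∀ bs k {ks ρ ls} → digits bs ++ ks ≡ ρ ++ 2 + k ∷ ls →
              ∃ λ ρ′ → ρ ≡ digits bs ++ ρ′ × ks ≡ ρ′ ++ 2 + k ∷ ls
drop-digits []       k {ρ = ρ} eq = ρ , refl , eq
drop-digits (𝟘 ∷ bs) k {ρ = []}    ()
drop-digits (𝟙 ∷ bs) k {ρ = []}    ()
drop-digits (b ∷ bs) k {ρ = x ∷ ρ} eq with drop-digits bs k {ρ = ρ} (∷-injectiveʳ eq) | ∷-injectiveˡ eq
... | ρ′ , refl , eq′ | refl = ρ′ , refl , eq′

block : List Bit × List Bit → List ℕ
block (bs , cs) = 0 ∷ 2 ∷ digits bs ++ 3 ∷ digits cs ++ 2 ∷ []

blocks : List (List Bit × List Bit) → List ℕ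
blocks = concatMap block

-- Excludes a match that begins at the closing marker of a block: nothing follows it, or 0 and then
-- 2, so the first non-digit is never 3.
blocks-marker : ∀ R bs {ks} → blocks R ≢ digits bs ++ 3 ∷ ks
blocks-marker []      []       ()
blocks-marker []      (_ ∷ _)  ()
blocks-marker (_ ∷ R) []       ()
blocks-marker (_ ∷ R) (𝟘 ∷ [])     ()
blocks-marker (_ ∷ R) (𝟘 ∷ 𝟘 ∷ bs) ()
blocks-marker (_ ∷ R) (𝟘 ∷ 𝟙 ∷ bs) ()
blocks-marker (_ ∷ R) (𝟙 ∷ bs) ()

-- The 2 that begins the match is the opening marker of the first block, which yields the entry, or
-- its closing marker, which is impossible, or lies in a later block.
factor-∈ : ∀ R ρ bs cs {ks} → blocks R ≡ ρ ++ 2 ∷ digits bs ++ 3 ∷ digits cs ++ 2 ∷ ks → (bs , cs) ∈ R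
factor-∈ []              []            bs cs ()
factor-∈ []              (_ ∷ _)       bs cs ()
factor-∈ ((ds , es) ∷ R) []            bs cs ()
-- Skipping only the initial 0 places the match at the opening marker.
factor-∈ ((ds , es) ∷ R) (0 ∷ [])      bs cs eq
  with split-at-marker ds bs 1 (trans (sym (++-assoc (digits ds) _ (blocks R))) (∷-injectiveʳ (∷-injectiveʳ eq)))
... | refl , eq₁ with split-at-marker es cs 0 (trans (sym (++-assoc (digits es) _ (blocks R))) eq₁)
... | refl , _ = here refl
factor-∈ ((ds , es) ∷ R) (suc _ ∷ [])  bs cs ()
factor-∈ ((ds , es) ∷ R) (_ ∷ _ ∷ ρ)   bs cs eq
  with drop-digits ds 0 {ρ = ρ} (trans (sym (++-assoc (digits ds) _ (blocks R))) (∷-injectiveʳ (∷-injectiveʳ eq)))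
... | [] , _ , ()
... | _ ∷ ρ₁ , _ , eq₁ with drop-digits es 0 {ρ = ρ₁} (trans (sym (++-assoc (digits es) _ (blocks R))) (∷-injectiveʳ eq₁))
-- Here the match would begin at the closing marker.
... | [] , _ , eq₂ = contradiction (∷-injectiveʳ eq₂) (blocks-marker R bs)
... | _ ∷ ρ₂ , _ , eq₂ = there (factor-∈ R ρ₂ bs cs (∷-injectiveʳ eq₂))

marker-in-block : ∀ bs cs ρ {ks} → ρ ++ 3 ∷ ks ≡ block (bs , cs) → ρ ≡ 0 ∷ 2 ∷ digits bs
marker-in-block bs cs (_ ∷ _ ∷ ρ) eq with ∷-injectiveˡ eq | ∷-injectiveˡ (∷-injectiveʳ eq)
... | refl | refl with drop-digits bs 1 {ρ = ρ} (sym (∷-injectiveʳ (∷-injectiveʳ eq)))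
... | [] , eq′ , _ = cong (λ ks → 0 ∷ 2 ∷ ks) (trans eq′ (++-identityʳ _))
... | _ ∷ ρ₁ , _ , eq₁ with drop-digits cs 1 {ρ = ρ₁} (∷-injectiveʳ eq₁)
... | [] , _ , ()
... | _ ∷ [] , _ , ()
... | _ ∷ _ ∷ _ , _ , ()

-- The leading 1 guards the marker behind it from being the tail of a longer run of 2's. In
-- `opening` it is the initial 0 of `block`; in `closing` it is the last letter before the marker
-- 2221.
opening closing : Σ* → Σ*
opening v = 𝟏 ∷ 𝟐 ∷ 𝟐 ∷ 𝟏 ∷ (v ∷ʳ 𝟐 ∷ʳ 𝟐 ∷ʳ 𝟐 ∷ʳ 𝟏)
closing w = 𝟏 ∷ 𝟐 ∷ 𝟐 ∷ 𝟐 ∷ 𝟏 ∷ (w ∷ʳ 𝟐 ∷ʳ 𝟐 ∷ʳ 𝟏)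

opening-++ : ∀ v w → opening v ++ w ≡ 𝟏 ∷ 𝟐 ∷ 𝟐 ∷ 𝟏 ∷ v ++ 𝟐 ∷ 𝟐 ∷ 𝟐 ∷ 𝟏 ∷ w
opening-++ v w = cong (λ u → 𝟏 ∷ 𝟐 ∷ 𝟐 ∷ 𝟏 ∷ u) (begin
  (v ∷ʳ 𝟐 ∷ʳ 𝟐 ∷ʳ 𝟐 ∷ʳ 𝟏) ++ w       ≡⟨ ++-assoc (v ∷ʳ 𝟐 ∷ʳ 𝟐 ∷ʳ 𝟐) _ w ⟩
  (v ∷ʳ 𝟐 ∷ʳ 𝟐 ∷ʳ 𝟐) ++ 𝟏 ∷ w        ≡⟨ ++-assoc (v ∷ʳ 𝟐 ∷ʳ 𝟐) _ _ ⟩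
  (v ∷ʳ 𝟐 ∷ʳ 𝟐) ++ 𝟐 ∷ 𝟏 ∷ w         ≡⟨ ++-assoc (v ∷ʳ 𝟐) _ _ ⟩
  (v ∷ʳ 𝟐) ++ 𝟐 ∷ 𝟐 ∷ 𝟏 ∷ w          ≡⟨ ++-assoc v _ _ ⟩
  v ++ 𝟐 ∷ 𝟐 ∷ 𝟐 ∷ 𝟏 ∷ w             ∎)
  where open ≡-Reasoning

closing-++ : ∀ w u → closing w ++ u ≡ 𝟏 ∷ 𝟐 ∷ 𝟐 ∷ 𝟐 ∷ 𝟏 ∷ w ++ 𝟐 ∷ 𝟐 ∷ 𝟏 ∷ u
closing-++ w u = cong (λ u → 𝟏 ∷ 𝟐 ∷ 𝟐 ∷ 𝟐 ∷ 𝟏 ∷ u) (begin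
  (w ∷ʳ 𝟐 ∷ʳ 𝟐 ∷ʳ 𝟏) ++ u       ≡⟨ ++-assoc (w ∷ʳ 𝟐 ∷ʳ 𝟐) _ u ⟩
  (w ∷ʳ 𝟐 ∷ʳ 𝟐) ++ 𝟏 ∷ u        ≡⟨ ++-assoc (w ∷ʳ 𝟐) _ _ ⟩
  (w ∷ʳ 𝟐) ++ 𝟐 ∷ 𝟏 ∷ u         ≡⟨ ++-assoc w _ _ ⟩
  w ++ 𝟐 ∷ 𝟐 ∷ 𝟏 ∷ u            ∎)
  where open ≡-Reasoning

-- f is the concatenation of opening v, w and 221, expressed through prefixes
-- and suffixes only: the marker 2221 determines where opening v ends in f.
IsBlock : Σ* → Σ* → Σ* → Set
IsBlock f v w = Prefix (opening v) f × Suffix (closing w) f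
  × (∀ g → Prefix g f → Suffix (𝟏 ∷ 𝟐 ∷ 𝟐 ∷ 𝟐 ∷ 𝟏 ∷ []) g → g ≡ opening v)

-- Stated negatively so that only universal bounded quantifiers occur.
Related : Σ* → Σ* → Σ* → Set
Related W v w = EndsInOne (𝟏 ∷ v) × EndsInOne (𝟏 ∷ w)
  × ¬ (∀ p → Prefix p W → ∀ f → Suffix f p → ¬ IsBlock f v w)

unparse-block : ∀ bs cs → unparse (block (bs , cs)) ≡ opening (encode bs) ++ encode cs ++ 𝟐 ∷ 𝟐 ∷ 𝟏 ∷ []
unparse-block bs cs = begin
  𝟏 ∷ 𝟐 ∷ 𝟐 ∷ 𝟏 ∷ unparse (digits bs ++ 3 ∷ digits cs ++ 2 ∷ [])
    ≡⟨ cong (λ u → 𝟏 ∷ 𝟐 ∷ 𝟐 ∷ 𝟏 ∷ u) (unparse-++ (digits bs) _) ⟩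
  𝟏 ∷ 𝟐 ∷ 𝟐 ∷ 𝟏 ∷ encode bs ++ 𝟐 ∷ 𝟐 ∷ 𝟐 ∷ 𝟏 ∷ unparse (digits cs ++ 2 ∷ [])
    ≡⟨ sym (opening-++ (encode bs) _) ⟩
  opening (encode bs) ++ unparse (digits cs ++ 2 ∷ [])
    ≡⟨ cong (opening (encode bs) ++_) (unparse-++ (digits cs) _) ⟩
  opening (encode bs) ++ encode cs ++ 𝟐 ∷ 𝟐 ∷ 𝟏 ∷ [] ∎
  where open ≡-Reasoning

unparse-isBlock : ∀ bs cs → IsBlock (unparse (block (bs , cs))) (encode bs) (encode cs)
unparse-isBlock bs cs = (_ , sym (unparse-block bs cs)) , closing-suffix , unique
  where
  open ≡-Reasoning

  closing-suffix : Suffix (closing (encode cs)) (unparse (block (bs , cs)))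
  -- The first letter of `closing` overlaps the last letter of 221 followed by the code of `bs`,
  -- which is 1 even if `bs` is empty.
  closing-suffix with unparse-endsInOne (digits bs)
  ... | r , eq = 𝟏 ∷ 𝟐 ∷ 𝟐 ∷ r , (begin
    𝟏 ∷ 𝟐 ∷ 𝟐 ∷ r ++ closing v                                        ≡⟨ cong (λ u → 𝟏 ∷ 𝟐 ∷ 𝟐 ∷ r ++ u) (sym (++-identityʳ (closing v))) ⟩
    𝟏 ∷ 𝟐 ∷ 𝟐 ∷ r ++ closing v ++ []                                  ≡⟨ cong (λ u → 𝟏 ∷ 𝟐 ∷ 𝟐 ∷ r ++ u) (closing-++ v []) ⟩
    𝟏 ∷ 𝟐 ∷ 𝟐 ∷ r ++ 𝟏 ∷ rest                                         ≡⟨ cong (λ u → 𝟏 ∷ 𝟐 ∷ 𝟐 ∷ u) (sym (++-assoc r (𝟏 ∷ []) rest)) ⟩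
    𝟏 ∷ 𝟐 ∷ 𝟐 ∷ (r ∷ʳ 𝟏) ++ rest                                      ≡⟨ cong (λ u → 𝟏 ∷ 𝟐 ∷ 𝟐 ∷ u ++ rest) eq ⟩
    𝟏 ∷ 𝟐 ∷ 𝟐 ∷ 𝟏 ∷ encode bs ++ rest                                 ≡⟨ sym (opening-++ (encode bs) _) ⟩
    opening (encode bs) ++ v ++ 𝟐 ∷ 𝟐 ∷ 𝟏 ∷ []                        ≡⟨ sym (unparse-block bs cs) ⟩
    unparse (block (bs , cs))                                         ∎)
    where
    v    = encode cs
    rest = 𝟐 ∷ 𝟐 ∷ 𝟐 ∷ 𝟏 ∷ v ++ 𝟐 ∷ 𝟐 ∷ 𝟏 ∷ []

  unique : ∀ g → Prefix g (unparse (block (bs , cs))) → Suffix (𝟏 ∷ 𝟐 ∷ 𝟐 ∷ 𝟐 ∷ 𝟏 ∷ []) g →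
           g ≡ opening (encode bs)
  unique g (q , g++q) (r , refl) = begin
    r ++ 𝟏 ∷ 𝟐 ∷ 𝟐 ∷ 𝟐 ∷ 𝟏 ∷ []              ≡⟨ sym (++-assoc r (𝟏 ∷ []) _) ⟩
    (r ∷ʳ 𝟏) ++ 𝟐 ∷ 𝟐 ∷ 𝟐 ∷ 𝟏 ∷ []           ≡⟨ cong (_++ 𝟐 ∷ 𝟐 ∷ 𝟐 ∷ 𝟏 ∷ []) (sym (unparse-parse 0 r)) ⟩
    unparse (parse 0 (r ∷ʳ 𝟏)) ++ 𝟐 ∷ 𝟐 ∷ 𝟐 ∷ 𝟏 ∷ [] ≡⟨ cong (λ ks → unparse ks ++ 𝟐 ∷ 𝟐 ∷ 𝟐 ∷ 𝟏 ∷ []) before ⟩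
    unparse (0 ∷ 2 ∷ digits bs) ++ 𝟐 ∷ 𝟐 ∷ 𝟐 ∷ 𝟏 ∷ [] ≡⟨ sym (opening-++ (encode bs) []) ⟩
    opening (encode bs) ++ []                ≡⟨ ++-identityʳ _ ⟩
    opening (encode bs)                      ∎
    where
    -- Read as numbers, `g` ends in a marker 3 of the block, and a block contains only one.
    before : parse 0 (r ∷ʳ 𝟏) ≡ 0 ∷ 2 ∷ digits bs
    before = marker-in-block bs cs _ (begin
      parse 0 (r ∷ʳ 𝟏) ++ 3 ∷ parse 0 q                  ≡⟨ sym (parse-++ 0 r _) ⟩
      parse 0 (r ++ 𝟏 ∷ 𝟐 ∷ 𝟐 ∷ 𝟐 ∷ 𝟏 ∷ q)               ≡⟨ cong (parse 0) (sym (++-assoc r _ q)) ⟩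
      parse 0 ((r ++ 𝟏 ∷ 𝟐 ∷ 𝟐 ∷ 𝟐 ∷ 𝟏 ∷ []) ++ q)        ≡⟨ cong (parse 0) g++q ⟩
      parse 0 (unparse (block (bs , cs)))                ≡⟨ parse-unparse _ ⟩
      block (bs , cs)                                    ∎)

-- The suffix condition splits off `closing w`; what precedes it, extended by the marker 12221, is a
-- prefix to which the last condition applies.
isBlock-unique : ∀ {f v w} → IsBlock f v w → f ≡ opening v ++ w ++ 𝟐 ∷ 𝟐 ∷ 𝟏 ∷ []
isBlock-unique {f} {v} {w} (_ , (r , refl) , unique) = begin
  r ++ closing w                                 ≡⟨ cong (r ++_) (trans (sym (++-identityʳ _)) (closing-++ w [])) ⟩
  r ++ marker ++ w ++ 𝟐 ∷ 𝟐 ∷ 𝟏 ∷ []             ≡⟨ sym (++-assoc r marker _) ⟩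
  (r ++ marker) ++ w ++ 𝟐 ∷ 𝟐 ∷ 𝟏 ∷ []           ≡⟨ cong (_++ w ++ 𝟐 ∷ 𝟐 ∷ 𝟏 ∷ []) (unique (r ++ marker)
    (w ++ 𝟐 ∷ 𝟐 ∷ 𝟏 ∷ [] , trans (++-assoc r marker _)
      (cong (r ++_) (trans (sym (closing-++ w [])) (++-identityʳ _)))) (r , refl)) ⟩
  opening v ++ w ++ 𝟐 ∷ 𝟐 ∷ 𝟏 ∷ []               ∎
  where
  open ≡-Reasoning
  marker = 𝟏 ∷ 𝟐 ∷ 𝟐 ∷ 𝟐 ∷ 𝟏 ∷ []

∈⇒Related : ∀ {R bs cs} → (bs , cs) ∈ R → Related (unparse (blocks R)) (encode bs) (encode cs)
∈⇒Related {R} {bs} {cs} i = unparse-endsInOne (digits bs) , unparse-endsInOne (digits cs) , holds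
  where
  holds : ¬ (∀ p → Prefix p (unparse (blocks R)) → ∀ f → Suffix f p → ¬ IsBlock f (encode bs) (encode cs))
  holds none with ∈-∃++ i
  ... | R₁ , R₂ , refl = none (unparse (blocks R₁) ++ unparse (block (bs , cs)))
    (unparse (blocks R₂) , (begin
      (unparse (blocks R₁) ++ unparse (block (bs , cs))) ++ unparse (blocks R₂)
        ≡⟨ ++-assoc (unparse (blocks R₁)) _ _ ⟩
      unparse (blocks R₁) ++ unparse (block (bs , cs)) ++ unparse (blocks R₂)
        ≡⟨ cong (unparse (blocks R₁) ++_) (sym (unparse-++ (block (bs , cs)) (blocks R₂))) ⟩
      unparse (blocks R₁) ++ unparse (block (bs , cs) ++ blocks R₂)
        ≡⟨ sym (unparse-++ (blocks R₁) _) ⟩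
      unparse (blocks R₁ ++ block (bs , cs) ++ blocks R₂)
        ≡⟨ cong unparse (sym (concatMap-++ block R₁ _)) ⟩
      unparse (blocks (R₁ ++ (bs , cs) ∷ R₂)) ∎))
    _ (unparse (blocks R₁) , refl) (unparse-isBlock bs cs)
    where open ≡-Reasoning

Related⇒∈ : ∀ {R bs cs} → Related (unparse (blocks R)) (encode bs) (encode cs) → ¬ ¬ (bs , cs) ∈ R
Related⇒∈ {R} {bs} {cs} (_ , _ , related) i∉ = related λ { p (q , eq) f (r , refl) isBlock →
  i∉ (factor-∈ R (parse 0 (r ∷ʳ 𝟏)) bs cs (factor r q (trans (cong (λ f → (r ++ f) ++ q) (sym (isBlock-unique isBlock))) eq))) }
  where
  open ≡-Reasoning
  v = encode bs
  w = encode cs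

  factor : ∀ r q → (r ++ opening v ++ w ++ 𝟐 ∷ 𝟐 ∷ 𝟏 ∷ []) ++ q ≡ unparse (blocks R) →
           blocks R ≡ parse 0 (r ∷ʳ 𝟏) ++ 2 ∷ digits bs ++ 3 ∷ digits cs ++ 2 ∷ parse 0 q
  factor r q eq = begin
    blocks R                                   ≡⟨ sym (parse-unparse (blocks R)) ⟩
    parse 0 (unparse (blocks R))               ≡⟨ cong (parse 0) (sym eq) ⟩
    parse 0 ((r ++ opening v ++ w ++ 𝟐 ∷ 𝟐 ∷ 𝟏 ∷ []) ++ q)
      ≡⟨ cong (parse 0) (trans (++-assoc r _ q) (cong (r ++_) (trans (++-assoc (opening v) _ q)
           (trans (cong (opening v ++_) (++-assoc w _ q)) (opening-++ v _))))) ⟩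
    parse 0 (r ++ 𝟏 ∷ 𝟐 ∷ 𝟐 ∷ 𝟏 ∷ v ++ 𝟐 ∷ 𝟐 ∷ 𝟐 ∷ 𝟏 ∷ w ++ 𝟐 ∷ 𝟐 ∷ 𝟏 ∷ q)
      ≡⟨ parse-++ 0 r _ ⟩
    parse 0 (r ∷ʳ 𝟏) ++ 2 ∷ parse 0 (v ++ 𝟐 ∷ 𝟐 ∷ 𝟐 ∷ 𝟏 ∷ w ++ 𝟐 ∷ 𝟐 ∷ 𝟏 ∷ q)
      ≡⟨ cong (λ ks → parse 0 (r ∷ʳ 𝟏) ++ 2 ∷ ks) (trans (parse-unparse-++ (digits bs) _)
           (cong (λ ks → digits bs ++ 3 ∷ ks) (parse-unparse-++ (digits cs) _))) ⟩
    parse 0 (r ∷ʳ 𝟏) ++ 2 ∷ digits bs ++ 3 ∷ digits cs ++ 2 ∷ parse 0 q ∎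

-- The graph of concatenation and its standard code

∈-inits⁺ : ∀ {A : Set} (xs ys : List A) → xs ∈ inits (xs ++ ys)
∈-inits⁺ []       ys = here refl
∈-inits⁺ (x ∷ xs) ys = there (∈-map⁺ (x ∷_) (∈-inits⁺ xs ys))

∈-inits⁻ : ∀ {A : Set} {xs : List A} zs → xs ∈ inits zs → ∃ λ ys → xs ++ ys ≡ zs
∈-inits⁻ zs       (here refl) = zs , refl
∈-inits⁻ (z ∷ zs) (there i) with ∈-map⁻ (z ∷_) i
... | xs , j , refl with ∈-inits⁻ zs j
... | ys , refl = ys , refl

graph : List Bit → List Bit → List (List Bit × List Bit)
graph x y = map (λ v → v , x ++ v) (inits y)

witness : List Bit → List Bit → Σ*
witness x y = unparse (blocks (graph x y))

Related-witness : ∀ x v v′ → Related (witness x (v ++ v′)) (encode v) (encode (x ++ v))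
Related-witness x v v′ = ∈⇒Related {R = graph x (v ++ v′)} (∈-map⁺ (λ v → v , x ++ v) (∈-inits⁺ v v′))

-- The bounds and the endings make `v` and `w` codes of strings; the listed pairs form the graph of
-- a function, which then fixes `w`.
Related-witness⁻ : ∀ x y {v w} → Prefix v (encode y) → Prefix w (encode (x ++ y)) →
  Related (witness x y) v w → ∃₂ λ u u′ → u ++ u′ ≡ y × v ≡ encode u × w ≡ encode (x ++ u)
Related-witness⁻ x y {v} {w} v⊑y w⊑z related@(v-end , w-end , _)
  with prefix-of-encode v y v⊑y v-end | prefix-of-encode w (x ++ y) w⊑z w-end
... | u , u′ , refl , refl | t , _ , _ , refl = u , u′ , refl , refl ,
  -- Membership is known only up to double negation, as `Related` is stated negatively; equality of
  -- words is decidable.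
  decidable-stable (encode t ≟ʷ encode (x ++ u)) λ w≢ → Related⇒∈ {graph x y} related λ i → w≢ (functional i)
  where
  functional : (u , t) ∈ graph x y → encode t ≡ encode (x ++ u)
  functional i with ∈-map⁻ (λ v → v , x ++ v) i
  ... | _ , _ , refl = refl

-- Appending a coded bit

appendBit : Bit → Term VWSig n → Term VWSig n
appendBit 𝟘 t = append 𝟏 t
appendBit 𝟙 t = append 𝟏 (append 𝟐 t)

encode-appendBit : ∀ bs b (e : Env n) {t} → ⟦ t ⟧ᵗ e ≡ encode bs →
                   ⟦ appendBit b t ⟧ᵗ e ≡ encode (bs ∷ʳ b)
encode-appendBit bs 𝟘 e eq = trans (cong (_∷ʳ 𝟏) eq) (sym (encode-++ bs (𝟘 ∷ [])))
encode-appendBit bs 𝟙 e eq = trans (cong (λ w → w ∷ʳ 𝟐 ∷ʳ 𝟏) eq)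
  (trans (++-assoc (encode bs) _ _) (sym (encode-++ bs (𝟙 ∷ []))))

word-encode-∷ʳ : ∀ bs b → word {n} (encode (bs ∷ʳ b)) ≡ appendBit b (word (encode bs))
word-encode-∷ʳ bs b = trans (cong word (encode-++ bs (b ∷ [])))
  (trans (foldl-++ (λ t d → append d t) ε (encode bs) (encode (b ∷ []))) (last-bit b))
  where
  last-bit : ∀ b → foldl (λ t d → append d t) (word (encode bs)) (encode (b ∷ [])) ≡ appendBit b (word (encode bs))
  last-bit 𝟘 = refl
  last-bit 𝟙 = refl

encode-first-bit : ∀ b bs {q} → encode (b ∷ []) ++ q ≡ encode bs → ∃ λ cs → bs ≡ b ∷ cs
encode-first-bit 𝟘 (𝟘 ∷ cs) eq = cs , refl
encode-first-bit 𝟙 (𝟙 ∷ cs) eq = cs , refl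

-- The codes 1 and 21 differ in their first letter, so once `encode u` is cancelled the next bit is
-- forced.
next-bit : ∀ u u′ b → Prefix (encode (u ∷ʳ b)) (encode (u ++ u′)) → ∃ λ u″ → u ++ u′ ≡ (u ∷ʳ b) ++ u″
next-bit u u′ b (q , eq)
  with encode-first-bit b u′ (++-cancelˡ (encode u) _ _ (begin
    encode u ++ encode (b ∷ []) ++ q   ≡⟨ sym (++-assoc (encode u) _ q) ⟩
    (encode u ++ encode (b ∷ [])) ++ q ≡⟨ cong (_++ q) (sym (encode-++ u (b ∷ []))) ⟩
    encode (u ∷ʳ b) ++ q               ≡⟨ eq ⟩
    encode (u ++ u′)                   ≡⟨ encode-++ u u′ ⟩
    encode u ++ encode u′              ∎))
  where open ≡-Reasoning
... | u″ , refl = u″ , sym (++-assoc u _ u″)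

encode-prefix : ∀ bs cs → Prefix (encode bs) (encode (bs ++ cs))
encode-prefix bs cs = encode cs , sym (encode-++ bs cs)

bounded-instance : ∀ {Q} (σ : Fin k → Term VWSig n) i (φ : Formula VWSig (suc k)) t →
  VW* ∣ Γ ⊢ subst σ (Bounded Q (var i) φ) → VW* ∣ Γ ⊢ rel Q (t ∷ σ i ∷ []) → VW* ∣ Γ ⊢ subst (t ◂ σ) φ
bounded-instance {Q = Q} σ i φ t p =
  ⇒-elim (∀-elim-liftS σ (rel Q (var zero ∷ var (suc i) ∷ []) ⇒ φ) t p)

-- The computation formula and its functionality

module Computation (related : Δ₀ 3) where

  relatedAt : Term VWSig n → Term VWSig n → Term VWSig n → Δ₀ n
  relatedAt W v w = at (W ◂ v ◂ w ◂ Vector.[]) related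

  -- The variables of step and closure are w, v, W, x, y, z; those of final are
  -- w, W, x, y, z.
  step : Bit → Δ₀ 6
  step b = appendBit b (var (# 1)) ⊑₀ var (# 4) ⇒₀
    appendBit b (var (# 0)) ⊑₀ var (# 5)
      ∧₀ relatedAt (var (# 2)) (appendBit b (var (# 1))) (appendBit b (var (# 0)))

  closure : Δ₀ 6
  closure = relatedAt (var (# 2)) (var (# 1)) (var (# 0)) ⇒₀ step 𝟘 ∧₀ step 𝟙

  final : Δ₀ 5
  final = relatedAt (var (# 1)) (var (# 3)) (var (# 0)) ⇒₀ var (# 0) ≐₀ var (# 4)

  -- W codes a relation that contains (e , x), is closed under appending the same
  -- bit to both components as long as the first remains a prefix of y, and
  -- relates y only to z.  The variables are W, x, y, z.
  computation : Δ₀ 4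
  computation = (var (# 1) ⊑₀ var (# 3) ∧₀ relatedAt (var (# 0)) ε (var (# 1)))
    ∧₀ ∀⊑ (# 2) (∀⊑ (# 4) closure)
    ∧₀ ∀⊑ (# 3) final

  Relates : Term VWSig n → Term VWSig n → Term VWSig n → Formula VWSig n
  Relates W v w = subst (W ◂ v ◂ w ◂ Vector.[]) ⌜ related ⌝

  relatedAt-instance : (σ : Fin k → Term VWSig n) (W v w : Term VWSig k) →
    subst σ ⌜ relatedAt W v w ⌝ ≡ Relates (substT σ W) (substT σ v) (substT σ w)
  relatedAt-instance σ W v w = trans (subst-subst σ (W ◂ v ◂ w ◂ Vector.[]) ⌜ related ⌝)
    (subst-cong (λ { zero → refl ; (suc zero) → refl ; (suc (suc zero)) → refl }) ⌜ related ⌝)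

  -- The closure clause is applied once per bit of `y`, by an induction outside the theory. This
  -- brings xy below `z` and relates it to `y`, so `final` at xy gives the equation.
  computation-functional : ∀ x y (W z : Term VWSig n) →
    VW* ∣ Γ ⊢ subst (W ◂ word (encode x) ◂ word (encode y) ◂ z ◂ Vector.[]) ⌜ computation ⌝ →
    VW* ∣ Γ ⊢ z ≐ word (encode (x ++ y))
  computation-functional {n} {Γ} x y W z p = ≐-sym (⇒-elim
      (bounded-instance σ (# 3) ⌜ final ⌝ (word (encode (x ++ y))) (∧-elim₂ (∧-elim₂ p)) (proj₁ reached))
      (cast (sym (relatedAt-instance (word (encode (x ++ y)) ◂ σ) (var (# 1)) (var (# 3)) (var (# 0)))) (proj₂ reached)))
    where
    σ = W ◂ word (encode x) ◂ word (encode y) ◂ z ◂ Vector.[]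

    -- The first component is the bound under which the quantifier over w can be instantiated at the
    -- next step.
    Reached : List Bit → Set
    Reached u = VW* ∣ Γ ⊢ word (encode (x ++ u)) ⊑ z
              × VW* ∣ Γ ⊢ Relates W (word (encode u)) (word (encode (x ++ u)))

    base : Reached []
    base = cast (cong (λ w → word (encode w) ⊑ z) (sym (++-identityʳ x))) (∧-elim₁ (∧-elim₁ p)) ,
           cast (trans (relatedAt-instance σ (var (# 0)) ε (var (# 1)))
                       (cong (λ w → Relates W ε (word (encode w))) (sym (++-identityʳ x))))
                (∧-elim₂ (∧-elim₁ p))

    steps : ∀ u u′ → u ++ u′ ≡ y → Reached u → ∀ b →
      VW* ∣ Γ ⊢ subst (word (encode (x ++ u)) ◂ word (encode u) ◂ σ) ⌜ step b ⌝
    steps u u′ eq (w⊑z , r) = λ { 𝟘 → ∧-elim₁ both ; 𝟙 → ∧-elim₂ both }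
      where
      both = ⇒-elim
        (bounded-instance (word (encode u) ◂ σ) (# 4) ⌜ closure ⌝ (word (encode (x ++ u)))
          (bounded-instance σ (# 2) ⌜ ∀⊑ (# 4) closure ⌝ (word (encode u)) (∧-elim₁ (∧-elim₂ p))
            (cast (cong (λ w → word (encode u) ⊑ word w) (trans (sym (encode-++ u u′)) (cong encode eq)))
              (prefix-⊑ (encode u) (encode u′))))
          w⊑z)
        (cast (sym (relatedAt-instance (word (encode (x ++ u)) ◂ word (encode u) ◂ σ) (var (# 2)) (var (# 1)) (var (# 0)))) r)

    substT-appendBit : ∀ {k m} (σ : Fin k → Term VWSig m) b t → substT σ (appendBit b t) ≡ appendBit b (substT σ t)
    substT-appendBit σ 𝟘 t = refl
    substT-appendBit σ 𝟙 t = refl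

    step-reached : ∀ u u″ b → (u ∷ʳ b) ++ u″ ≡ y → Reached u → Reached (u ∷ʳ b)
    step-reached u u″ b eq reach =
      cast (cong (_⊑ z) (appended-w)) (∧-elim₁ next) ,
      cast (trans (relatedAt-instance ρ (var (# 2)) (appendBit b (var (# 1))) (appendBit b (var (# 0))))
             (cong₂ (Relates W) appended-v appended-w)) (∧-elim₂ next)
      where
      ρ = word (encode (x ++ u)) ◂ word (encode u) ◂ σ

      appended-v : substT ρ (appendBit b (var (# 1))) ≡ word (encode (u ∷ʳ b))
      appended-v = trans (substT-appendBit ρ b _) (sym (word-encode-∷ʳ u b))

      appended-w : substT ρ (appendBit b (var (# 0))) ≡ word (encode (x ++ u ∷ʳ b))
      appended-w = trans (substT-appendBit ρ b _) (trans (sym (word-encode-∷ʳ (x ++ u) b))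
        (cong (word ∘ encode) (++-assoc x u _)))

      next = ⇒-elim (steps u (b ∷ u″) (trans (sym (++-assoc u _ u″)) eq) reach b)
        (cast (cong₂ _⊑_ (sym appended-v) (cong word (trans (sym (encode-++ (u ∷ʳ b) u″)) (cong encode eq))))
          (prefix-⊑ (encode (u ∷ʳ b)) (encode u″)))

    reach : ∀ u u′ → u ++ u′ ≡ y → Reached u → Reached y
    reach u []       eq r = ≡-subst Reached (trans (sym (++-identityʳ u)) eq) r
    reach u (b ∷ u′) eq r = reach (u ∷ʳ b) u′ eq′ (step-reached u u′ b eq′ r)
      where eq′ = trans (++-assoc u _ u′) eq

    reached : Reached y
    reached = reach [] y refl base

-- The formula reading a relation off a word

openingT closingT : Term VWSig n → Term VWSig n
openingT v = prepend 𝟏 (prepend 𝟐 (prepend 𝟐 (prepend 𝟏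
  (append 𝟏 (append 𝟐 (append 𝟐 (append 𝟐 v)))))))
closingT w = prepend 𝟏 (prepend 𝟐 (prepend 𝟐 (prepend 𝟐 (prepend 𝟏
  (append 𝟏 (append 𝟐 (append 𝟐 w)))))))

endsInOne : Term VWSig n → Δ₀ n
endsInOne t = word (𝟏 ∷ []) ⊒₀ t

-- The variables of isBlock are f, v, w; those of coded are W, v, w.
isBlock : Δ₀ 3
isBlock = openingT (var (# 1)) ⊑₀ var (# 0) ∧₀ closingT (var (# 2)) ⊒₀ var (# 0)
  ∧₀ ∀⊑ (# 0) (word (𝟏 ∷ 𝟐 ∷ 𝟐 ∷ 𝟐 ∷ 𝟏 ∷ []) ⊒₀ var (# 0) ⇒₀ var (# 0) ≐₀ openingT (var (# 2)))

coded : Δ₀ 3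
coded = endsInOne (prepend 𝟏 (var (# 1))) ∧₀ endsInOne (prepend 𝟏 (var (# 2)))
  ∧₀ ¬₀ ∀⊑ (# 0) (∀⊒ (# 0) (¬₀ at (var (# 0) ◂ var (# 3) ◂ var (# 4) ◂ Vector.[]) isBlock))

open Computation coded

environment : List Bit → List Bit → Env 4
environment x y = witness x y ◂ encode x ◂ encode y ◂ encode (x ++ y) ◂ Vector.[]

-- The truth conditions of `coded` and `isBlock` compute to `Related` and `IsBlock`, so the facts
-- about words apply as they stand.
computation-true : ∀ x y → ⟦ computation ⟧ (environment x y)
computation-true x y = (encode-prefix x y , start) , closed , final-true
  where
  start : Related (witness x y) [] (encode x)
  start = ≡-subst (λ z → Related (witness x y) [] (encode z)) (++-identityʳ x) (Related-witness x [] y)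

  step-true : ∀ b u u′ → u ++ u′ ≡ y → ⟦ step b ⟧ (encode (x ++ u) ◂ encode u ◂ environment x y)
  step-true b u u′ eq v⊑y =
    extended (next-bit u u′ b (subst₂ Prefix appended-v (cong encode (sym eq)) v⊑y))
    where
    e : Env 6
    e = encode (x ++ u) ◂ encode u ◂ environment x y

    appended-v : ⟦ appendBit b (var (# 1)) ⟧ᵗ e ≡ encode (u ∷ʳ b)
    appended-v = encode-appendBit u b e {var (# 1)} refl

    appended-w : ⟦ appendBit b (var (# 0)) ⟧ᵗ e ≡ encode (x ++ u ∷ʳ b)
    appended-w = trans (encode-appendBit (x ++ u) b e {var (# 0)} refl)
      (cong encode (++-assoc x u (b ∷ [])))

    extended : (∃ λ u″ → u ++ u′ ≡ (u ∷ʳ b) ++ u″) →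
      Prefix (⟦ appendBit b (var (# 0)) ⟧ᵗ e) (encode (x ++ y))
        × Related (witness x y) (⟦ appendBit b (var (# 1)) ⟧ᵗ e) (⟦ appendBit b (var (# 0)) ⟧ᵗ e)
    extended (u″ , eq′) =
      subst₂ Prefix (sym appended-w) (cong encode (trans (++-assoc x _ u″) (cong (x ++_) y≡)))
        (encode-prefix (x ++ u ∷ʳ b) u″) ,
      ≡-subst (λ y → Related (witness x y) _ _) y≡
        (subst₂ (Related _) (sym appended-v) (sym appended-w) (Related-witness x (u ∷ʳ b) u″))
      where
      y≡ : (u ∷ʳ b) ++ u″ ≡ y
      y≡ = trans (sym eq′) eq

  closed : ∀ v → Prefix v (encode y) → ∀ w → Prefix w (encode (x ++ y)) →
           Related (witness x y) v w → ⟦ step 𝟘 ∧₀ step 𝟙 ⟧ (w ◂ v ◂ environment x y)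
  closed v v⊑y w w⊑z r with Related-witness⁻ x y v⊑y w⊑z r
  ... | u , u′ , eq , refl , refl = step-true 𝟘 u u′ eq , step-true 𝟙 u u′ eq

  final-true : ∀ w → Prefix w (encode (x ++ y)) → Related (witness x y) (encode y) w → w ≡ encode (x ++ y)
  final-true w w⊑z r with Related-witness⁻ x y ([] , ++-identityʳ _) w⊑z r
  ... | u , u′ , _ , eq , refl = cong (λ y → encode (x ++ y)) (sym (encode-injective eq))

decided-true : ∀ {P φ} → P → Decided Γ P φ → VW* ∣ Γ ⊢ φ
decided-true x (inj₁ (_ , p))  = p
decided-true x (inj₂ (¬x , _)) = contradiction x ¬x

computation-provable : ∀ x y →
  VW* ∣ Γ ⊢ subst (word (witness x y) ◂ word (encode x) ◂ word (encode y) ◂ word (encode (x ++ y)) ◂ Vector.[]) ⌜ computation ⌝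
computation-provable x y = decided-true (computation-true x y) (decide computation
    (word (witness x y) ◂ word (encode x) ◂ word (encode y) ◂ word (encode (x ++ y)) ◂ Vector.[]) (environment x y)
    (λ { zero → ≐-refl ; (suc zero) → ≐-refl ; (suc (suc zero)) → ≐-refl ; (suc (suc (suc zero))) → ≐-refl }))

-- Making a definable relation a total function

module Total {T : Theory VWSig} (ψ : Formula VWSig 3) where

  infix 9 _⟨_⨾_⨾_⟩

  _⟨_⨾_⨾_⟩ : Formula VWSig 3 → Term VWSig n → Term VWSig n → Term VWSig n → Formula VWSig n
  φ ⟨ a ⨾ b ⨾ c ⟩ = subst (a ◂ b ◂ c ◂ Vector.[]) φ

  -- Building uniqueness into the formula makes functionality a matter of logic, for nonstandard
  -- arguments as well.
  unique : Formula VWSig 3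
  unique = ψ ∧ ∀′ (ψ ⟨ var (# 1) ⨾ var (# 2) ⨾ var (# 0) ⟩ ⇒ var (# 0) ≐ var (# 3))

  exists : Formula VWSig 2
  exists = ∃′ (unique ⟨ var (# 1) ⨾ var (# 2) ⨾ var (# 0) ⟩)

  existsAt : Term VWSig n → Term VWSig n → Formula VWSig n
  existsAt a b = subst (a ◂ b ◂ Vector.[]) exists

  -- The function defined by ψ, with value e where ψ does not determine one.
  total : Formula VWSig 3
  total = unique ∨ ((¬′ existsAt (var (# 0)) (var (# 1))) ∧ var (# 2) ≐ ε)

  private
    variable
      a b c d : Term VWSig n

  at-at : (σ : Fin k → Term VWSig n) (φ : Formula VWSig 3) {a b c : Term VWSig k} →
          subst σ (φ ⟨ a ⨾ b ⨾ c ⟩) ≡ φ ⟨ substT σ a ⨾ substT σ b ⨾ substT σ c ⟩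
  at-at σ φ = trans (subst-subst σ _ φ)
    (subst-cong (λ { zero → refl ; (suc zero) → refl ; (suc (suc zero)) → refl }) φ)

  unique-intro : T ∣ Γ ⊢ ψ ⟨ a ⨾ b ⨾ c ⟩ →
    T ∣ Γ ⊢ ∀′ (ψ ⟨ renameT suc a ⨾ renameT suc b ⨾ var zero ⟩ ⇒ var zero ≐ renameT suc c) →
    T ∣ Γ ⊢ unique ⟨ a ⨾ b ⨾ c ⟩
  unique-intro p q = ∧-intro p (cast (cong (λ φ → ∀′ (φ ⇒ _)) (sym (at-at _ ψ))) q)

  unique-functional : T ∣ Γ ⊢ unique ⟨ a ⨾ b ⨾ c ⟩ → T ∣ Γ ⊢ unique ⟨ a ⨾ b ⨾ d ⟩ → T ∣ Γ ⊢ c ≐ d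
  unique-functional {c = c} p q = ⇒-elim
    (∀-elim-liftS _ (ψ ⟨ var (# 1) ⨾ var (# 2) ⨾ var (# 0) ⟩ ⇒ var (# 0) ≐ var (# 3)) c (∧-elim₂ q))
    (cast (sym (at-at _ ψ)) (∧-elim₁ p))

  unique-exists : T ∣ Γ ⊢ unique ⟨ a ⨾ b ⨾ c ⟩ → T ∣ Γ ⊢ existsAt a b
  unique-exists {c = c} p = ∃-intro-liftS _ (unique ⟨ var (# 1) ⨾ var (# 2) ⨾ var (# 0) ⟩) c
    (cast (sym (at-at _ unique)) p)

  existsAt-at : (σ : Fin k → Term VWSig n) {a b : Term VWSig k} →
                subst σ (existsAt a b) ≡ existsAt (substT σ a) (substT σ b)
  existsAt-at σ = trans (subst-subst σ _ exists) (subst-cong (λ { zero → refl ; (suc zero) → refl }) exists)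

  total-unique : T ∣ Γ ⊢ unique ⟨ a ⨾ b ⨾ c ⟩ → T ∣ Γ ⊢ total ⟨ a ⨾ b ⨾ c ⟩
  total-unique = ∨-intro₁

  total-default : T ∣ Γ ⊢ ¬′ existsAt a b → T ∣ Γ ⊢ c ≐ ε → T ∣ Γ ⊢ total ⟨ a ⨾ b ⨾ c ⟩
  total-default p q = ∨-intro₂ (∧-intro (cast (cong ¬′_ (sym (existsAt-at _))) p) q)

  total-elim : ∀ {χ} → T ∣ Γ ⊢ total ⟨ a ⨾ b ⨾ c ⟩ → T ∣ unique ⟨ a ⨾ b ⨾ c ⟩ ∷ Γ ⊢ χ →
               T ∣ c ≐ ε ∷ ¬′ existsAt a b ∷ Γ ⊢ χ → T ∣ Γ ⊢ χ
  total-elim p q r = ∨-elim p q (⇒-elim (⇒-elim (wk (⇒-intro (⇒-intro r)))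
    (cast (cong ¬′_ (existsAt-at _)) (∧-elim₁ hyp₀))) (∧-elim₂ hyp₀))

  -- In the mixed cases a unique value both exists and does not.
  total-functional : T ∣ Γ ⊢ total ⟨ a ⨾ b ⨾ c ⟩ → T ∣ Γ ⊢ total ⟨ a ⨾ b ⨾ d ⟩ → T ∣ Γ ⊢ c ≐ d
  total-functional p q = total-elim p
    (total-elim (wk q)
      (unique-functional hyp₁ hyp₀)
      (ex-falso (⇒-elim hyp₁ (unique-exists hyp₂))))
    (total-elim (wk (wk q))
      (ex-falso (⇒-elim hyp₂ (unique-exists hyp₀)))
      (≐-trans hyp₂ (≐-sym hyp₀)))

  -- Excluded middle inside the theory: the arguments may be nonstandard, and then nothing tells
  -- whether `ψ` determines a value.
  total-total : T ∣ Γ ⊢ ∃′ (total ⟨ renameT suc a ⨾ renameT suc b ⨾ var zero ⟩)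
  total-total {n} {a = a} {b} = ∨-elim (excluded-middle {φ = existsAt a b})
    (∃-mono (total-unique (cast renamed hyp₀)) hyp₀)
    (∃-intro ε (cast (sym instantiated) (total-default {a = a} {b} hyp₀ ≐-refl)))
    where
    renamed : subst (liftS (a ◂ b ◂ Vector.[])) (unique ⟨ var (# 1) ⨾ var (# 2) ⨾ var (# 0) ⟩)
            ≡ unique ⟨ renameT suc a ⨾ renameT suc b ⨾ var zero ⟩
    renamed = at-at (liftS (a ◂ b ◂ Vector.[])) unique

    instantiated : (total ⟨ renameT suc a ⨾ renameT suc b ⨾ var zero ⟩) [ ε ] ≡ total ⟨ a ⨾ b ⨾ ε ⟩
    instantiated = trans (at-at (ε ◂ var) total)
      (cong₂ (λ a b → total ⟨ a ⨾ b ⨾ ε ⟩) (substT-weaken ε a) (substT-weaken ε b))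

open Total {VW*} (∃′ ⌜ computation ⌝)

concatenation : ∀ x y → VW* ∣ Γ ⊢ unique ⟨ word (encode x) ⨾ word (encode y) ⨾ word (encode (x ++ y)) ⟩
concatenation {n} x y = unique-intro
  (∃-intro-liftS (word (encode x) ◂ word (encode y) ◂ word (encode (x ++ y)) ◂ Vector.[]) ⌜ computation ⌝
    (word (witness x y)) (computation-provable x y))
  -- The coding word and the value are fresh variables here, so neither is known to be standard.
  (∀-intro (⇒-intro (∃-elim hyp₀ (cast renamed
    (computation-functional x y (var (# 0)) (var (# 1)) (cast opened hyp₀))))))
  where
  twice : ∀ w → renameT suc (renameT suc (word {n} w)) ≡ word w
  twice w = trans (cong (renameT suc) (renameT-word suc w)) (renameT-word suc w)

  σ τ : Fin 4 → Term VWSig (suc (suc n))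
  σ = liftS (renameT suc (word (encode x)) ◂ renameT suc (word (encode y)) ◂ var zero ◂ Vector.[])
  τ = var (# 0) ◂ word (encode x) ◂ word (encode y) ◂ var (# 1) ◂ Vector.[]

  σ≗τ : σ ≗ τ
  σ≗τ zero                   = refl
  σ≗τ (suc zero)             = twice (encode x)
  σ≗τ (suc (suc zero))       = twice (encode y)
  σ≗τ (suc (suc (suc zero))) = refl

  opened : subst σ ⌜ computation ⌝ ≡ subst τ ⌜ computation ⌝
  opened = subst-cong σ≗τ ⌜ computation ⌝

  renamed : var (# 1) ≐ word (encode (x ++ y)) ≡ weaken (var zero ≐ renameT suc (word (encode (x ++ y))))
  renamed = cong (var (# 1) ≐_) (sym (twice (encode (x ++ y))))

-- The interpretation

code : B* → Σ*
code = encode ∘ List⁺.toList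

-- Ending in 1 excludes the empty prefix as well as those that cut through a code 21.
initialSegment : Formula VWSig 2
initialSegment = var (# 0) ⊑ var (# 1) ∧ word (𝟏 ∷ []) ⊒ var (# 0)

relations : ∀ {k} → WDRel k → Formula VWSig k
relations ≼-sym = initialSegment
relations C-sym = total

open Direct code relations

code-injective : ∀ {s t} → code s ≡ code t → s ≡ t
code-injective {s} {t} eq with encode-injective {List⁺.toList s} {List⁺.toList t} eq
... | refl = refl

encode-endsInOne : ∀ b bs → EndsInOne (encode (b ∷ bs))
encode-endsInOne 𝟘 bs = unparse-endsInOne (digits bs)
encode-endsInOne 𝟙 bs = ∷-endsInOne 𝟐 (unparse-endsInOne (digits bs))

initialSegments-prefix : ∀ {s} t → s ∈ List⁺.toList (initialSegments t) → Prefix (code s) (code t) × EndsInOne (code s)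
initialSegments-prefix (b ∷ bs) i with ∈-map⁻ (b ∷_) i
... | cs , j , refl with ∈-inits⁻ bs j
... | ds , refl = encode-prefix (b ∷ cs) ds , encode-endsInOne b cs

prefix-initialSegments : ∀ {w} t → Prefix w (code t) → EndsInOne w →
                         ∃ λ s → s ∈ List⁺.toList (initialSegments t) × w ≡ code s
prefix-initialSegments {w} (b ∷ bs) w⊑t w-end with prefix-of-encode w (b ∷ bs) w⊑t (∷-endsInOne 𝟏 w-end)
... | []     , _  , _    , refl = contradiction w-end λ { ([] , ()) ; (_ ∷ _ , ()) }
... | _ ∷ cs , ds , refl , refl = b ∷ cs , ∈-map⁺ (b ∷_) (∈-inits⁺ cs ds) , refl

-- Initial segments as finite disjunctions

module _ {A : Set} {T : Theory VWSig} where

  ⋁-intro : (f : A → Formula VWSig n) → ∀ l {x} → x ∈ List⁺.toList l → T ∣ Γ ⊢ f x → T ∣ Γ ⊢ ⋁ (List⁺.map f l)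
  ⋁-intro f (x ∷ xs) = go x xs
    where
    go : ∀ x xs {y} → y ∈ x ∷ xs → T ∣ Γ ⊢ f y → T ∣ Γ ⊢ ⋁ (List⁺.map f (x ∷ xs))
    go x []       (here refl) p = p
    go x (_ ∷ xs) (here refl) p = ∨-intro₁ p
    go x (y ∷ xs) (there i)   p = ∨-intro₂ (go y xs i p)

  ⋁-elim : (f : A → Formula VWSig n) → ∀ l {χ} → (∀ x → x ∈ List⁺.toList l → ∀ {Δ} → T ∣ f x ∷ Δ ⊢ χ) →
           T ∣ Γ ⊢ ⋁ (List⁺.map f l) → T ∣ Γ ⊢ χ
  ⋁-elim f (x ∷ xs) h p = ⇒-elim (⇒-intro (go x xs h)) p
    where
    go : ∀ x xs {χ} → (∀ y → y ∈ x ∷ xs → ∀ {Δ} → T ∣ f y ∷ Δ ⊢ χ) → ∀ {Δ} → T ∣ ⋁ (List⁺.map f (x ∷ xs)) ∷ Δ ⊢ χ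
    go x []       h = h x (here refl)
    go x (y ∷ xs) h = ∨-elim hyp₀ (h x (here refl)) (go y xs (λ z i → h z (there i)))

⋁-map-homo : ∀ {A : Set} {L M : Signature} (g : Formula L n → Formula M m) →
  (∀ φ ψ → g (φ ∨ ψ) ≡ g φ ∨ g ψ) → (f : A → Formula L n) (f′ : A → Formula M m) →
  (∀ x → g (f x) ≡ f′ x) → ∀ l → g (⋁ (List⁺.map f l)) ≡ ⋁ (List⁺.map f′ l)
⋁-map-homo g homo f f′ eq (x ∷ xs) = go x xs
  where
  go : ∀ x xs → g (⋁ (List⁺.map f (x ∷ xs))) ≡ ⋁ (List⁺.map f′ (x ∷ xs))
  go x []       = eq x
  go x (y ∷ xs) = trans (homo _ _) (cong₂ _∨_ (eq x) (go y xs))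

isSegmentOf : B* → Term VWSig n → Formula VWSig n
isSegmentOf t x = ⋁ (List⁺.map (λ s → x ≐ word (code s)) (initialSegments t))

-- Put as a bounded quantification, the claim reduces to the finitely many prefixes of `code t`, and
-- for each of them it is decided whether it ends in 1.
segments⇒ : ∀ t → VW* ∣ Γ ⊢ Bounded ⊑-sym (word (code t)) (word (𝟏 ∷ []) ⊒ var zero ⇒ isSegmentOf t (var zero))
segments⇒ {Γ = Γ} t = bounded-⊑ (code t) λ p p⊑t → below p p⊑t (decide-⊒ (𝟏 ∷ []) p)
  where
  substituted : ∀ p → isSegmentOf t (var zero) [ word p ] ≡ isSegmentOf t (word p)
  substituted p = ⋁-map-homo (_[ word p ]) (λ _ _ → refl)
    (λ s → var zero ≐ word (code s)) (λ s → word p ≐ word (code s))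
    (λ s → cong (word p ≐_) (substT-word (word p ◂ var) (code s))) (initialSegments t)

  below : ∀ p → Prefix p (code t) → Decided Γ (EndsInOne p) (word (𝟏 ∷ []) ⊒ word p) →
          VW* ∣ Γ ⊢ (word (𝟏 ∷ []) ⊒ var zero ⇒ isSegmentOf t (var zero)) [ word p ]
  below p p⊑t (inj₂ (_ , q)) = ⇒-intro (ex-falso (⇒-elim (wk q) hyp₀))
  below p p⊑t (inj₁ (p-end , _)) with prefix-initialSegments t p⊑t p-end
  ... | s , i , refl = ⇒-intro (cast (sym (substituted p))
    (⋁-intro (λ s → word p ≐ word (code s)) (initialSegments t) i ≐-refl))

segments⇐ : ∀ t {x : Term VWSig n} → VW* ∣ Γ ⊢ isSegmentOf t x →
            VW* ∣ Γ ⊢ x ⊑ word (code t) ∧ word (𝟏 ∷ []) ⊒ x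
segments⇐ t {x} = ⋁-elim (λ s → x ≐ word (code s)) (initialSegments t) λ s i →
  ≐-replace₂ initialSegment (≐-sym hyp₀) ≐-refl (∧-intro (below s i) (ends s i))
  where
  below : ∀ s → s ∈ List⁺.toList (initialSegments t) → VW* ∣ Γ ⊢ word (code s) ⊑ word (code t)
  below s i with initialSegments-prefix t i
  ... | (q , eq) , _ = cast (cong (λ w → word (code s) ⊑ word w) eq) (prefix-⊑ (code s) q)

  ends : ∀ s → s ∈ List⁺.toList (initialSegments t) → VW* ∣ Γ ⊢ word (𝟏 ∷ []) ⊒ word (code s)
  ends s i with initialSegments-prefix t i
  ... | _ , (r , eq) = cast (cong (λ w → word (𝟏 ∷ []) ⊒ word w) eq) (suffix-⊒ r (𝟏 ∷ []))

segments⇔ : ∀ t → VW* ∣ Γ ⊢ ∀′ (var zero ⊑ word (code t) ∧ word (𝟏 ∷ []) ⊒ var zero ⇔ isSegmentOf t (var zero))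
segments⇔ t = ∀-mono
  (∧-intro
    (⇒-intro (⇒-elim (⇒-elim hyp₁ (∧-elim₁ hyp₀)) (∧-elim₂ hyp₀)))
    (⇒-intro (segments⇐ t hyp₀)))
  (cast (bounded-word (code t) _) (segments⇒ t))

at-lookup : (φ : Formula VWSig 3) (a b c : Term WDSig n) →
            subst (directT ∘ lookup (a ∷ b ∷ c ∷ [])) φ ≡ φ ⟨ directT a ⨾ directT b ⨾ directT c ⟩
at-lookup φ a b c = subst-cong (λ { zero → refl ; (suc zero) → refl ; (suc (suc zero)) → refl }) φ

WD-axioms : ∀ {φ} → WD_R φ → VW* ∣ Γ ⊢ direct (rename Vector.[] φ)
WD-axioms (wd1 s t)     = cast (sym (at-lookup total (str s) (str t) (str (s ⁺++⁺ t))))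
  (total-unique {a = word (code s)} {b = word (code t)} {c = word (code (s ⁺++⁺ t))}
    (concatenation (List⁺.toList s) (List⁺.toList t)))
WD-axioms (wd2 s t s≢t) = word-≢ (s≢t ∘ code-injective)
WD-axioms (wd3 t)       = cast (cong (λ φ → ∀′ (var zero ⊑ word (code t) ∧ word (𝟏 ∷ []) ⊒ var zero ⇔ φ))
    (sym (⋁-map-homo (direct ∘ rename (liftR Vector.[])) (λ _ _ → refl) _ _ (λ _ → refl) (initialSegments t))))
  (segments⇔ t)
WD-axioms wd4           = ∀-intro (∀-intro (cast
  (cong ∃′ (sym (at-lookup total (var (# 2)) (var (# 1)) (var (# 0)))))
  (total-total {a = var (# 1)} {b = var (# 0)})))
WD-axioms wd5           = ∀-intro (∀-intro (∀-intro (∀-intro (⇒-intro (total-functional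
  (cast (at-lookup total (var (# 3)) (var (# 2)) (var (# 1))) (∧-elim₁ hyp₀))
  (cast (at-lookup total (var (# 3)) (var (# 2)) (var (# 0))) (∧-elim₂ hyp₀)))))))

theorem6p19 : VW* Interprets WD_R
theorem6p19 = direct-interprets (λ ax → WD-axioms ax)
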